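{- Let $W=\mathcal{S}_n$ with $S=\{s_1,\dots,s_{n-1}\}$ (type $A_{n-1}$), and let $J\subset S$ have size $m$. Then the squashing map $(I,p)\mapsto \mathbb{S}q(p)$ is a bijection $$\mathbb{S}q^J\colon \{(I,p)\mid I\subset S,\ p \text{ is a core } (I,J)\text{ -coset}\}\to \mathcal{S}_{n-m}.$$ Moreover, for every core $(I,J)$-coset $p$, squashing induces a bijection $(p_1,\dots,p_k)\mapsto(\mathbb{S}q(p_1),\dots,\mathbb{S}q(p_k))$ from the set of atomic reduced expressions for $p$ to the set of ordinary reduced expressions of the permutation $\mathbb{S}q(p)$ in the simple reflections of $\mathcal{S}_{n-m}$.
   Context: $\mathcal{S}_n$ acts on $X=\{1<\dots<n\}$, $s_i=(i\ i{+}1)$, $\ell$ is the Coxeter length. For $I\subset S$, $W_I$ is the parabolic subgroup, $w_I$ its longest element, $\ell(I)=\ell(w_I)$. An $(I,J)$-coset is an element $p\in W_I\backslash W/W_J$ (with $(I,J)$ part of the data), with Bruhat-maximal element $\overline p$ and Bruhat-minimal element $\underline p$. It is a core coset if $I=\underline pJ\underline p^{ -1}$. Composition: let $*$ be the $0$-Hecke (star) product on $W$ (so $s*w=sw$ if $\ell(sw)>\ell(w)$ and $s*w=w$ otherwise). For an $(I,J)$-coset $p$ and a $(J,K)$-coset $q$, $p*q$ is the $(I,K)$-coset $W_I(\overline p*\overline q)W_K$, and $\overline{p*q}=\overline p*\overline q$. It is reduced if $\overline{p}*\overline q=(\overline pw_J^{ -1})\overline q$ with $\ell(\overline p*\overline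 q)=\ell(\overline p)-\ell(J)+\ell(\overline q)$. A longer composition $p_1*\cdots*p_k$ is reduced if each successive composition $(p_1*\cdots*p_i)*p_{i+1}$ is reduced. Atomic coset: for $M\subset S$, $s\in M$, $t=w_Msw_M$, the $(M\setminus\{s\},M\setminus\{t\})$-coset containing $w_M$. An atomic reduced expression for a core coset $p$ is a sequence $(p_1,\dots,p_k)$ of composable atomic cosets whose composition is reduced and equals $p$ (with $k=0$ allowed for the identity coset $W_I\in W_I\backslash W/W_I$). Squashing: for $J\subset S$ let $\sim_J$ be the equivalence relation on $X$ generated by $j\sim_J j+1$ whenever $s_j\in J$. Its classes $C^{(J)}_1<\dots<C^{(J)}_{n-m}$ ($m=\#J$) are contiguous intervals, so the ordered set $X/{\sim_J}$ is identified with $\{1<\dots<n-m\}$. For $I,J$ of size $m$, a permutation $y$ of $X$ is a block permutation relative to $I$ and $J$ if it sends each class $C_c^{(J)}$ by an order-preserving bijection onto some class $C_{c'}^{(I)}$; then $\mathbb{S}q(y)\in\mathcal{S}_{n-m}$ is the induced permutation $c\mapsto c'$. For a core $(I,J)$-coset $p$, $\underline p$ is a block permutation relative to $I$ and $J$, and $\mathbb{S}q(p):=\mathbb{S}q(\underline p)$. -}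

module Defs where

open import Data.Bool.Base using (if_then_else_)
open import Data.Fin.Base using (Fin; zero; suc; toℕ; inject₁; punchIn)
import Data.Fin.Base as Fin
import Data.Fin.Properties as Fin
open import Data.Fin.Permutation
  using (Permutation′; _≈_; _⟨$⟩ʳ_; _∘ₚ_; flip; transpose; remove; lift₀;
         lift₀-transpose; punchIn-permute; inverseˡ; inverseʳ)
  renaming (id to idₚ)
open import Data.Fin.Subset using (Subset; inside; outside; _∈_; _-_; ∣_∣)
open import Data.Fin.Subset.Properties using (∣p∣≤n)
open import Data.List.Base using (List; []; _∷_; _++_; length; map; foldr)
open import Data.Nat.Base using (ℕ; zero; suc; _+_; _∸_; _≤_; _<_; z≤n; s≤s)
open import Data.Nat.Properties
  using (_<?_; suc-injective; +-∸-assoc)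
open import Data.Product.Base using (∃; ∃₂; Σ; _×_; _,_; proj₁; proj₂)
open import Data.Vec.Base using (_∷_; here; there)
open import Function.Base using (_∘_; _on_)
open import Function.Bundles using (_⇔_; mk⇔)
open import Relation.Binary.Bundles using (Setoid)
open import Relation.Binary.Construct.Closure.Equivalence
  using (EqClosure; fold; gmap; symmetric; return)
open import Relation.Binary.Construct.Closure.ReflexiveTransitive using (ε; _◅◅_)
import Relation.Binary.Construct.On as On
open import Relation.Binary.PropositionalEquality
  using (_≡_; refl; sym; trans; cong; isEquivalence)
open import Relation.Nullary.Decidable using (Dec; yes; no; does; map′; _×-dec_)
open import Relation.Nullary.Negation using (contradiction)

------------------------------------------------------------------------
-- The symmetric group S_n for n = suc r, with simple reflections indexed
-- by Fin r.  All indices are 0-based: s i swaps the points i and i + 1 of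
-- Fin (suc r), so Subset r is the collection of subsets of S.

private
  variable
    n r : ℕ

infixl 7 _·_
infix  8 _⁻¹

-- Permutations act on the left: (x · y)(i) = x (y i).
_·_ : Permutation′ n → Permutation′ n → Permutation′ n
x · y = y ∘ₚ x

_⁻¹ : Permutation′ n → Permutation′ n
x ⁻¹ = flip x

Sym : ℕ → Setoid _ _
Sym n = record
  { Carrier       = Permutation′ n
  ; _≈_           = _≈_
  ; isEquivalence = record
    { refl  = λ _ → refl
    ; sym   = λ p i → sym (p i)
    ; trans = λ p q i → trans (p i) (q i)
    }
  }

s : Fin r → Permutation′ (suc r)
s i = transpose (inject₁ i) (suc i)

Word : ℕ → Set
Word r = List (Fin r)

eval : Word r → Permutation′ (suc r)
eval []      = idₚ
eval (i ∷ u) = s i · eval u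

------------------------------------------------------------------------
-- The simple reflections generate S_n.  This is only needed so that the
-- search for a word of minimal length below terminates.

eval-++ : (u v : Word r) → eval (u ++ v) ≈ eval u · eval v
eval-++ []      v k = refl
eval-++ (i ∷ u) v k = cong (s i ⟨$⟩ʳ_) (eval-++ u v k)

eval-suc : (u : Word r) → eval (map suc u) ≈ lift₀ (eval u)
eval-suc []      zero    = refl
eval-suc []      (suc k) = refl
eval-suc (i ∷ u) k       = trans
  (cong (s (suc i) ⟨$⟩ʳ_) (eval-suc u k))
  (trans (lift₀-transpose (inject₁ i) (suc i) (lift₀ (eval u) ⟨$⟩ʳ k)) (lift₀-∘ k))
  where
  lift₀-∘ : ∀ k → lift₀ (s i) ⟨$⟩ʳ (lift₀ (eval u) ⟨$⟩ʳ k) ≡ lift₀ (s i · eval u) ⟨$⟩ʳ k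
  lift₀-∘ zero    = refl
  lift₀-∘ (suc k) = refl

-- a word for the cycle 0 ↦ j, k + 1 ↦ punchIn j k
cycle : Fin (suc r) → Word r
cycle         zero    = []
cycle {suc r} (suc j) = map suc (cycle j) ++ zero ∷ []

cycle-0 : (j : Fin (suc r)) → eval (cycle j) ⟨$⟩ʳ zero ≡ j
cycle-0         zero    = refl
cycle-0 {suc r} (suc j) = trans (eval-++ (map suc (cycle j)) _ zero)
  (trans (eval-suc (cycle j) (suc zero)) (cong suc (cycle-0 j)))

cycle-suc : (j : Fin (suc r)) (k : Fin r) → eval (cycle j) ⟨$⟩ʳ suc k ≡ punchIn j k
cycle-suc         zero    k       = refl
cycle-suc {suc r} (suc j) zero    = trans (eval-++ (map suc (cycle j)) _ (suc zero))
  (eval-suc (cycle j) zero)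
cycle-suc {suc r} (suc j) (suc k) = trans (eval-++ (map suc (cycle j)) _ (suc (suc k)))
  (trans (eval-suc (cycle j) (suc (suc k))) (cong suc (cycle-suc j k)))

generated : (w : Permutation′ (suc r)) → ∃ λ u → eval u ≈ w
generated {zero}  w = [] , λ { zero → fin1 (w ⟨$⟩ʳ zero) }
  where
  fin1 : (k : Fin 1) → zero ≡ k
  fin1 zero = refl
generated {suc r} w = cycle (w ⟨$⟩ʳ zero) ++ map suc u , correct
  where
  u = proj₁ (generated (remove zero w))
  correct : eval (cycle (w ⟨$⟩ʳ zero) ++ map suc u) ≈ w
  correct zero    = trans (eval-++ (cycle (w ⟨$⟩ʳ zero)) (map suc u) zero)
    (trans (cong (eval (cycle (w ⟨$⟩ʳ zero)) ⟨$⟩ʳ_) (eval-suc u zero))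
           (cycle-0 (w ⟨$⟩ʳ zero)))
  correct (suc k) = trans (eval-++ (cycle (w ⟨$⟩ʳ zero)) (map suc u) (suc k))
    (trans (cong (eval (cycle (w ⟨$⟩ʳ zero)) ⟨$⟩ʳ_) (eval-suc u (suc k)))
    (trans (cycle-suc (w ⟨$⟩ʳ zero) (eval u ⟨$⟩ʳ k))
    (trans (cong (punchIn (w ⟨$⟩ʳ zero)) (proj₂ (generated (remove zero w)) k))
           (sym (punchIn-permute w zero k)))))

------------------------------------------------------------------------
-- Coxeter length

least : {P : ℕ → Set} → (∀ k → Dec (P k)) → ∀ d → P d →
        ∃ λ k → P k × (∀ j → P j → k ≤ j)
least P? zero    p = zero , p , λ _ _ → z≤n
least P? (suc d) p with P? zero
... | yes p₀ = zero , p₀ , λ _ _ → z≤n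
... | no ¬p₀ with least (P? ∘ suc) d p
...   | k , pₖ , min = suc k , pₖ ,
          λ { zero p₀ → contradiction p₀ ¬p₀ ; (suc j) pⱼ → s≤s (min j pⱼ) }

anyWord? : {P : Word r → Set} → (∀ u → Dec (P u)) →
           ∀ k → Dec (∃ λ u → length u ≡ k × P u)
anyWord? P? zero = map′
  (λ p → [] , refl , p) (λ { ([] , refl , p) → p }) (P? [])
anyWord? P? (suc k) = map′
  (λ { (i , u , refl , p) → i ∷ u , refl , p })
  (λ { (i ∷ u , refl , p) → i , u , refl , p })
  (Fin.any? λ i → anyWord? (P? ∘ (i ∷_)) k)

minimalWord : (w : Permutation′ (suc r)) →
  ∃ λ u → eval u ≈ w × (∀ v → eval v ≈ w → length u ≤ length v)
minimalWord w with generated w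
... | u₀ , e₀ with least (anyWord? λ u → Fin.all? λ i → (eval u ⟨$⟩ʳ i) Fin.≟ (w ⟨$⟩ʳ i))
                         (length u₀) (u₀ , refl , e₀)
...   | _ , (u , refl , e) , min = u , e , λ v eᵥ → min (length v) (v , refl , eᵥ)

reducedWord : Permutation′ (suc r) → Word r
reducedWord w = proj₁ (minimalWord w)

ℓ : Permutation′ (suc r) → ℕ
ℓ w = length (reducedWord w)

ReducedExpression : Permutation′ (suc r) → Set
ReducedExpression {r} w = Σ (Word r) λ u → eval u ≈ w × length u ≡ ℓ w

ReducedExpressions : Permutation′ (suc r) → Setoid _ _
ReducedExpressions {r} w = record
  { Carrier       = ReducedExpression w
  ; _≈_           = _≡_ on proj₁
  ; isEquivalence = On.isEquivalence proj₁ isEquivalence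
  }

------------------------------------------------------------------------
-- 0-Hecke product: x * y = s₁ * (s₂ * ⋯ (sₖ * y)) for a reduced word
-- s₁ ⋯ sₖ of x, since then x = s₁ * ⋯ * sₖ.

infixr 7 _*ₛ_
infixl 7 _*_

_*ₛ_ : Fin r → Permutation′ (suc r) → Permutation′ (suc r)
i *ₛ w = if does (ℓ w <? ℓ (s i · w)) then s i · w else w

_*_ : Permutation′ (suc r) → Permutation′ (suc r) → Permutation′ (suc r)
x * y = foldr _*ₛ_ y (reducedWord x)

------------------------------------------------------------------------
-- Bruhat order

IsReflection : Permutation′ (suc r) → Set
IsReflection t = ∃₂ λ w i → t ≈ w · s i · w ⁻¹

infix 4 _≤ᴮ_

data _≤ᴮ_ (x : Permutation′ (suc r)) : Permutation′ (suc r) → Set where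
  equal : ∀ {y} → x ≈ y → x ≤ᴮ y
  step  : ∀ {y z} t → x ≤ᴮ y → IsReflection t → z ≈ t · y → ℓ y < ℓ z → x ≤ᴮ z

------------------------------------------------------------------------
-- Parabolic subgroups and their longest elements

data _∈W_ (x : Permutation′ (suc r)) (I : Subset r) : Set where
  gen : ∀ i → i ∈ I → x ≈ s i → x ∈W I
  one : x ≈ idₚ → x ∈W I
  mul : ∀ y z → y ∈W I → z ∈W I → x ≈ y · z → x ∈W I
  inv : ∀ y → y ∈W I → x ≈ y ⁻¹ → x ∈W I

IsLongest : Subset r → Permutation′ (suc r) → Set
IsLongest I w = w ∈W I × (∀ x → x ∈W I → ℓ x ≤ ℓ w)

------------------------------------------------------------------------
-- Double cosets.  W_I \ W / W_J is the setoid of representatives, so an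
-- (I , J)-coset p is given by any of its elements, and x ∼⟨ I , J ⟩ p
-- also expresses that x is an element of p.

infix 4 _∼⟨_,_⟩_

_∼⟨_,_⟩_ : Permutation′ (suc r) → Subset r → Subset r → Permutation′ (suc r) → Set
x ∼⟨ I , J ⟩ y = ∃₂ λ u v → u ∈W I × v ∈W J × x ≈ u · y · v

∼-refl : ∀ {I J : Subset r} x → x ∼⟨ I , J ⟩ x
∼-refl x = idₚ , idₚ , one (λ _ → refl) , one (λ _ → refl) , λ _ → refl

∼-sym : ∀ {I J : Subset r} x y → x ∼⟨ I , J ⟩ y → y ∼⟨ I , J ⟩ x
∼-sym x y (u , v , u∈ , v∈ , e) =
  u ⁻¹ , v ⁻¹ , inv u u∈ (λ _ → refl) , inv v v∈ (λ _ → refl) , λ i → sym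
    (trans (cong (u ⁻¹ ⟨$⟩ʳ_) (e (v ⁻¹ ⟨$⟩ʳ i)))
    (trans (inverseˡ u) (cong (y ⟨$⟩ʳ_) (inverseʳ v))))

∼-trans : ∀ {I J : Subset r} x y z →
          x ∼⟨ I , J ⟩ y → y ∼⟨ I , J ⟩ z → x ∼⟨ I , J ⟩ z
∼-trans x y z (u , v , u∈ , v∈ , e) (u′ , v′ , u′∈ , v′∈ , e′) =
  u · u′ , v′ · v , mul u u′ u∈ u′∈ (λ _ → refl) , mul v′ v v′∈ v∈ (λ _ → refl) ,
  λ i → trans (e i) (cong (u ⟨$⟩ʳ_) (e′ (v ⟨$⟩ʳ i)))

Cosets : Subset r → Subset r → Setoid _ _
Cosets {r} I J = record
  { Carrier       = Permutation′ (suc r)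
  ; _≈_           = _∼⟨ I , J ⟩_
  ; isEquivalence = record
    { refl  = λ {x} → ∼-refl x
    ; sym   = λ {x} {y} → ∼-sym x y
    ; trans = λ {x} {y} {z} → ∼-trans x y z
    }
  }

Coset : Subset r → Subset r → Set
Coset I J = Setoid.Carrier (Cosets I J)

-- x is the greatest (respectively least) element of p in the Bruhat order.
IsMaximal : (I J : Subset r) → Coset I J → Permutation′ (suc r) → Set
IsMaximal I J p x = x ∼⟨ I , J ⟩ p × (∀ y → y ∼⟨ I , J ⟩ p → y ≤ᴮ x)

IsMinimal : (I J : Subset r) → Coset I J → Permutation′ (suc r) → Set
IsMinimal I J p x = x ∼⟨ I , J ⟩ p × (∀ y → y ∼⟨ I , J ⟩ p → x ≤ᴮ y)

-- I = x J x⁻¹ as sets of simple reflections.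
IsConjugate : Subset r → Permutation′ (suc r) → Subset r → Set
IsConjugate I x J =
    (∀ i → i ∈ I → ∃ λ j → j ∈ J × s i ≈ x · s j · x ⁻¹)
  × (∀ j → j ∈ J → ∃ λ i → i ∈ I × s i ≈ x · s j · x ⁻¹)

IsCore : (I J : Subset r) → Coset I J → Set
IsCore I J p = ∃ λ p̲ → IsMinimal I J p p̲ × IsConjugate I p̲ J

record CoreCoset (J : Subset r) : Set where
  constructor core
  field
    I      : Subset r
    p      : Coset I J
    isCore : IsCore I J p

CoreCosets : Subset r → Setoid _ _
CoreCosets J = record
  { Carrier       = CoreCoset J
  ; _≈_           = λ a b → I a ≡ I b × p a ∼⟨ I a , J ⟩ p b
  ; isEquivalence = record
    { refl  = λ {a} → refl , ∼-refl (p a)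
    ; sym   = λ { {core _ p _} {core _ q _} (refl , e) → refl , ∼-sym p q e }
    ; trans = λ { {core _ p _} {core _ q _} {core _ c _} (refl , e) (refl , e′) →
                  refl , ∼-trans p q c e e′ }
    }
  }
  where open CoreCoset

------------------------------------------------------------------------
-- Reduced composition: p * q is reduced and equal to c.  The length
-- condition is ℓ(p̄ * q̄) = ℓ(p̄) - ℓ(J) + ℓ(q̄) with the subtraction
-- moved to the other side.

record IsReducedComposite (I J K : Subset r)
       (p : Coset I J) (q : Coset J K) (c : Coset I K) : Set where
  field
    p̄ q̄ wJ    : Permutation′ (suc r)
    p̄-maximal : IsMaximal I J p p̄
    q̄-maximal : IsMaximal J K q q̄
    wJ-longest : IsLongest J wJ
    product    : p̄ * q̄ ≈ (p̄ · wJ ⁻¹) · q̄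
    lengths    : ℓ (p̄ * q̄) + ℓ wJ ≡ ℓ p̄ + ℓ q̄
    composite  : c ∼⟨ I , K ⟩ p̄ * q̄

------------------------------------------------------------------------
-- Atomic cosets and atomic reduced expressions

-- For s = s a in M and t = s b = w_M s w_M, the (M ∖ {s} , M ∖ {t})-coset
-- containing w_M.
record IsAtomic (I J : Subset r) (p : Coset I J) : Set where
  field
    M          : Subset r
    a b        : Fin r
    wM         : Permutation′ (suc r)
    a∈M        : a ∈ M
    wM-longest : IsLongest M wM
    b-def      : s b ≈ wM · s a · wM
    I-def      : I ≡ M - a
    J-def      : J ≡ M - b
    wM∈p       : wM ∼⟨ I , J ⟩ p

AtomicCoset : Subset r → Subset r → Set
AtomicCoset I J = Σ (Coset I J) (IsAtomic I J)

infixl 5 _∷ʳ_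

data AtomicSequence (I : Subset r) : Subset r → Set where
  []   : AtomicSequence I I
  _∷ʳ_ : ∀ {J K} → AtomicSequence I J → AtomicCoset J K → AtomicSequence I K

infix 4 _≋_

data _≋_ {I : Subset r} : ∀ {J} → AtomicSequence I J → AtomicSequence I J → Set where
  []   : [] ≋ []
  _∷ʳ_ : ∀ {J K} {ps qs : AtomicSequence I J} {p q : AtomicCoset J K} →
         ps ≋ qs → proj₁ p ∼⟨ J , K ⟩ proj₁ q → (ps ∷ʳ p) ≋ (qs ∷ʳ q)

≋-refl : ∀ {I J : Subset r} (ps : AtomicSequence I J) → ps ≋ ps
≋-refl []       = []
≋-refl (ps ∷ʳ p) = ≋-refl ps ∷ʳ ∼-refl (proj₁ p)

≋-sym : ∀ {I J : Subset r} {ps qs : AtomicSequence I J} → ps ≋ qs → qs ≋ ps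
≋-sym []                          = []
≋-sym (_∷ʳ_ {p = p} {q = q} es e) = ≋-sym es ∷ʳ ∼-sym (proj₁ p) (proj₁ q) e

≋-trans : ∀ {I J : Subset r} {ps qs rs : AtomicSequence I J} →
          ps ≋ qs → qs ≋ rs → ps ≋ rs
≋-trans []                          []                           = []
≋-trans (_∷ʳ_ {p = p} {q = q} es e) (_∷ʳ_ {q = q′} es′ e′) =
  ≋-trans es es′ ∷ʳ ∼-trans (proj₁ p) (proj₁ q) (proj₁ q′) e e′

-- ps ↠ c: the composition of ps, bracketed to the left, is reduced and
-- equal to c.  It is started from the identity coset W_I, which is a unit
-- for composition and composes reducedly with every (I , J)-coset.

infix 4 _↠_

data _↠_ {I : Subset r} : ∀ {J} → AtomicSequence I J → Coset I J → Set where
  []   : ∀ {c} → c ∼⟨ I , I ⟩ idₚ → [] ↠ c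
  _∷ʳ_ : ∀ {J K c d} {ps : AtomicSequence I J} {p : AtomicCoset J K} →
         ps ↠ c → IsReducedComposite I J K c (proj₁ p) d → (ps ∷ʳ p) ↠ d

AtomicReducedExpression : (I J : Subset r) → Coset I J → Set
AtomicReducedExpression I J p = Σ (AtomicSequence I J) (_↠ p)

AtomicReducedExpressions : (I J : Subset r) → Coset I J → Setoid _ _
AtomicReducedExpressions I J p = record
  { Carrier       = AtomicReducedExpression I J p
  ; _≈_           = _≋_ on proj₁
  ; isEquivalence = On.isEquivalence proj₁ record
    { refl  = λ {ps} → ≋-refl ps
    ; sym   = ≋-sym
    ; trans = ≋-trans
    }
  }

------------------------------------------------------------------------
-- The equivalence relation ∼_J and its classes

infix 4 _∼[_]_

_∼[_]_ : Fin (suc r) → Subset r → Fin (suc r) → Set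
x ∼[ J ] y = EqClosure (λ x y → ∃ λ j → j ∈ J × x ≡ inject₁ j × y ≡ suc j) x y

-- The (0-based) position of the class of a point among the classes of ∼_J:
-- the number of generators s_j ∉ J with j below the point.
class : Subset r → Fin (suc r) → ℕ
class J             zero    = 0
class (inside  ∷ J) (suc x) = class J x
class (outside ∷ J) (suc x) = suc (class J x)

-- class J identifies the ordered set X/∼_J with {0 < ⋯ < r - ∣J∣}: see
-- class-∼, class-mono, class-bounded and class-onto.

∼-suc : ∀ {b} {J : Subset r} {x y} → x ∼[ J ] y → suc x ∼[ b ∷ J ] suc y
∼-suc = gmap suc λ { (j , j∈ , refl , refl) → suc j , there j∈ , refl , refl }

class-step : ∀ {J : Subset r} {j} → j ∈ J → class J (inject₁ j) ≡ class J (suc j)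
class-step here                                = refl
class-step {J = inside  ∷ J} (there {i = j} j∈) = class-step j∈
class-step {J = outside ∷ J} (there {i = j} j∈) = cong suc (class-step j∈)

class-≡ : (J : Subset r) → ∀ x y → class J x ≡ class J y → x ∼[ J ] y
class-≡ J             zero    zero    e = ε
class-≡ (inside  ∷ J) zero    (suc y) e =
  return (zero , here , refl , refl) ◅◅ ∼-suc (class-≡ J zero y e)
class-≡ (inside  ∷ J) (suc x) zero    e = symmetric _
  (return (zero , here , refl , refl) ◅◅ ∼-suc (class-≡ J zero x (sym e)))
class-≡ (inside  ∷ J) (suc x) (suc y) e = ∼-suc (class-≡ J x y e)
class-≡ (outside ∷ J) (suc x) (suc y) e = ∼-suc (class-≡ J x y (suc-injective e))

class-∼ : (J : Subset r) → ∀ x y → x ∼[ J ] y ⇔ class J x ≡ class J y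
class-∼ J x y = mk⇔
  (fold (On.isEquivalence (class J) isEquivalence)
        λ { (j , j∈ , refl , refl) → class-step j∈ })
  (class-≡ J x y)

class-mono : (J : Subset r) → ∀ x y → x Fin.≤ y → class J x ≤ class J y
class-mono J             zero    y       x≤y       = z≤n
class-mono (inside  ∷ J) (suc x) (suc y) (s≤s x≤y) = class-mono J x y x≤y
class-mono (outside ∷ J) (suc x) (suc y) (s≤s x≤y) = s≤s (class-mono J x y x≤y)

class-bounded : (J : Subset r) → ∀ x → class J x ≤ r ∸ ∣ J ∣
class-bounded             J             zero    = z≤n
class-bounded             (inside  ∷ J) (suc x) = class-bounded J x
class-bounded {r = suc r} (outside ∷ J) (suc x)
  rewrite +-∸-assoc 1 (∣p∣≤n J) = s≤s (class-bounded J x)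

class-onto : (J : Subset r) → ∀ c → c ≤ r ∸ ∣ J ∣ → ∃ λ x → class J x ≡ c
class-onto J              zero    c≤ = zero , refl
class-onto (inside  ∷ J) (suc c) c≤ with class-onto J (suc c) c≤
... | x , e = suc x , e
class-onto {r = suc r} (outside ∷ J) (suc c) c≤
  rewrite +-∸-assoc 1 (∣p∣≤n J) with c≤
... | s≤s c≤′ with class-onto J c c≤′
...   | x , e = suc x , cong suc e

------------------------------------------------------------------------
-- Squashing.  As m = ∣ J ∣ ≤ r, the number of classes n - m is
-- suc (r ∸ m).

-- y is a block permutation relative to I and J, with 𝕊q(y) = σ: it sends
-- the class of index c, by an order-preserving bijection, onto the class
-- of index σ c.
record IsSquash (m : ℕ) (I J : Subset r)
       (y : Permutation′ (suc r)) (σ : Permutation′ (suc (r ∸ m))) : Set where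
  field
    ∣I∣≡m : ∣ I ∣ ≡ m
    ∣J∣≡m : ∣ J ∣ ≡ m
    onto  : ∀ c x → class J x ≡ toℕ c ⇔ class I (y ⟨$⟩ʳ x) ≡ toℕ (σ ⟨$⟩ʳ c)
    mono  : ∀ x x′ → class J x ≡ class J x′ → x Fin.< x′ → y ⟨$⟩ʳ x Fin.< y ⟨$⟩ʳ x′

-- 𝕊q(p) = σ
IsCosetSquash : (m : ℕ) (I J : Subset r) → Coset I J → Permutation′ (suc (r ∸ m)) → Set
IsCosetSquash m I J p σ = ∃ λ p̲ → IsMinimal I J p p̲ × IsSquash m I J p̲ σ

-- (𝕊q(p₁), …, 𝕊q(pₖ)) = (s c₁, …, s cₖ)
data IsSequenceSquash (m : ℕ) {I : Subset r} :
     ∀ {J} → AtomicSequence I J → Word (r ∸ m) → Set where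
  []   : IsSequenceSquash m [] []
  _∷ʳ_ : ∀ {J K u c} {ps : AtomicSequence I J} {p : AtomicCoset J K} →
         IsSequenceSquash m ps u → IsCosetSquash m J K (proj₁ p) (s c) →
         IsSequenceSquash m (ps ∷ʳ p) (u ++ c ∷ [])

{-# OPTIONS --safe #-}

-- An (I , J)-coset is core exactly when it contains a block permutation y, that
-- is, one matching the adjacent pairs of J with those of I.  Its double coset is
-- then y W_J, with minimum y and maximum y w_J.  For block permutations x and y,
-- the composite of their cosets is reduced iff ℓ (x y) = ℓ x + ℓ y, iff x undoes
-- no inversion of y.  As block permutations are increasing on classes, the last
-- condition can be read off the induced permutations of the classes, so it
-- passes to the squashes and back without counting the sizes of blocks.
-- A block permutation with trivial squash is increasing, hence the identity;
-- this gives injectivity.  The atomic cosets into J swap two adjacent blocks,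
-- one coset for each simple reflection of the squashed group.  Words are lifted
-- from right to left, since J is fixed and I is determined on the way.
module Submission where

open import Defs
open import Data.Bool.Base using (Bool; true; false; _xor_; if_then_else_)
open import Data.Fin.Base using (Fin; zero; suc; toℕ; inject₁)
import Data.Fin.Base as Fin
import Data.Fin.Properties as Fin
open import Data.Fin.Permutation
  using (Permutation; Permutation′; permutation; _≈_; _⟨$⟩ʳ_; _⟨$⟩ˡ_; lift₀; lift₀-transpose;
         inverseˡ; inverseʳ; reverse; ↔⇒≡)
  renaming (id to idₚ)
open import Data.Fin.Subset
  using (Subset; inside; outside; ⊤; ⁅_⁆; _∈_; _∉_; _⊆_; _-_; ∣_∣)
open import Data.Fin.Subset.Properties
  using (_∈?_; ⊆-antisym; ∣p∣≤n; p─⊥≡p; p─q⊆p; x∈p∧x≢y⇒x∈p-y)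
open import Data.List.Base using (List; []; _∷_; _++_; length; foldr)
open import Data.List.Properties using (length-++; ∷ʳ-injective)
open import Data.List.Reverse using (Reverse; []; _∶_∶ʳ_; reverseView)
open import Data.Nat.Base using (ℕ; zero; suc; pred; _+_; _∸_; _≤_; _<_; z≤n; s≤s)
open import Data.Nat.Properties
open import Data.Nat.Tactic.RingSolver using (solve-∀)
open import Data.Product.Base using (Σ; ∃; ∃₂; _×_; _,_; proj₁; proj₂)
open import Data.Sum.Base using (_⊎_; inj₁; inj₂; [_,_]′)
open import Data.Vec.Base using (_∷_; here; there; _[_]≔_)
open import Function.Base using (_∘_; _on_)
open import Function.Bundles using (Bijection; Equivalence; Injection; mk⇔)
open import Function.Properties.Inverse using (↔⇒↣)
open import Relation.Binary.Definitions using (Transitive; Tri; tri<; tri≈; tri>)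
open import Relation.Binary.PropositionalEquality hiding (J)
open import Relation.Nullary.Decidable
  using (Dec; yes; no; does; dec-true; dec-false; decidable-stable; toSum; _×-dec_)
open import Relation.Nullary.Negation using (¬_; contradiction)

import Algebra.Properties.CommutativeMonoid.Sum
open Algebra.Properties.CommutativeMonoid.Sum +-0-commutativeMonoid
  using (sum; sum-cong-≗; ∑-distrib-+; sum-permute; sum-replicate-zero)

private
  variable
    m n r : ℕ

-- `ℓ` comes from a search for a shortest word and `_*_` folds over the word found, so neither can
-- be handled by unfolding. For `ℓ` the substitute is an inversion count with an exact product rule:
-- the gap between `ℓ x + ℓ y` and `ℓ (x · y)` is twice the number of pairs that y reverses and x
-- restores. This turns length additivity into the pointwise condition `Additive x y`, which makes
-- sense for points and for classes alike. For `_*_` the product is evaluated by an induction over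
-- an arbitrary word of minimal length, so the word chosen does not matter.
--
-- Reducedness is stated with the maxima x w_J and y w_K, whereas squashing sees only the minima x
-- and y. The bridge is that y w_K cannot be lengthened on the left by a reflection from J, so it
-- absorbs w_J: the star product is x y w_K, and the lengths of w_J and w_K cancel from the length
-- condition.
--
-- The minimum of an atomic coset is w_M w_J, with J the right-hand set: w_J reverses every J-class
-- and w_M reverses every M-class, so the J-classes end up in their original internal order while
-- the two inside a split M-class trade places.

injective : (x : Permutation′ n) {i j : Fin n} → x ⟨$⟩ʳ i ≡ x ⟨$⟩ʳ j → i ≡ j
injective x = Injection.injective (↔⇒↣ x)

≮⇒> : {i j : Fin n} → ¬ i Fin.< j → i ≢ j → j Fin.< i
≮⇒> i≮j i≢j = ≤∧≢⇒< (≮⇒≥ i≮j) (i≢j ∘ sym ∘ Fin.toℕ-injective)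

≈-sym : (x y : Permutation′ n) → x ≈ y → y ≈ x
≈-sym _ _ e i = sym (e i)

≈-trans : (x y z : Permutation′ n) → x ≈ y → y ≈ z → x ≈ z
≈-trans _ _ _ e f i = trans (e i) (f i)

·-congˡ : (x y z : Permutation′ n) → y ≈ z → x · y ≈ x · z
·-congˡ x _ _ e i = cong (x ⟨$⟩ʳ_) (e i)

-- Inversions

∑₂ : (Fin n → Fin n → ℕ) → ℕ
∑₂ f = sum λ i → sum (f i)

∑₂-cong : {f g : Fin n → Fin n → ℕ} → (∀ i j → f i j ≡ g i j) → ∑₂ f ≡ ∑₂ g
∑₂-cong e = sum-cong-≗ λ i → sum-cong-≗ (e i)

∑₂-+ : (f g : Fin n → Fin n → ℕ) → ∑₂ (λ i j → f i j + g i j) ≡ ∑₂ f + ∑₂ g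
∑₂-+ f g = trans (sum-cong-≗ λ i → ∑-distrib-+ (f i) (g i))
                 (∑-distrib-+ (sum ∘ f) (sum ∘ g))

∑₂-permute : (f : Fin n → Fin n → ℕ) (x : Permutation′ n) →
             ∑₂ f ≡ ∑₂ λ i j → f (x ⟨$⟩ʳ i) (x ⟨$⟩ʳ j)
∑₂-permute f x = trans (sum-permute (sum ∘ f) x)
  (sum-cong-≗ λ i → sum-permute (f (x ⟨$⟩ʳ i)) x)

sum-0 : (f : Fin n → ℕ) → (∀ i → f i ≡ 0) → sum f ≡ 0
sum-0 {n} f e = trans (sum-cong-≗ e) (sum-replicate-zero n)

sum-0⁻¹ : (f : Fin n → ℕ) → sum f ≡ 0 → ∀ i → f i ≡ 0
sum-0⁻¹ f e zero    = m+n≡0⇒m≡0 (f zero) e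
sum-0⁻¹ f e (suc i) = sum-0⁻¹ (f ∘ suc) (m+n≡0⇒n≡0 (f zero) e) i

lt : Fin n → Fin n → Bool
lt i j = does (i Fin.<? j)

δ : Bool → Bool → ℕ
δ a b = if a xor b then 1 else 0

ε : Bool → Bool → Bool → ℕ
ε a b c = if a xor b then (if b xor c then 2 else 0) else 0

-- The triangle inequality for the discrete metric on two values is strict only when b differs from
-- both a and c, which then agree; the excess is 2.
δ-triangle : ∀ a b c → δ a c + ε a b c ≡ δ a b + δ b c
δ-triangle true  true  true  = refl
δ-triangle true  true  false = refl
δ-triangle true  false true  = refl
δ-triangle true  false false = refl
δ-triangle false true  true  = refl
δ-triangle false true  false = refl
δ-triangle false false true  = refl
δ-triangle false false false = refl

-- Summing over ordered pairs counts every inversion twice, but makes the sum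
-- invariant under reindexing by a permutation.
2inv : Permutation′ n → ℕ
2inv x = ∑₂ λ i j → δ (lt i j) (lt (x ⟨$⟩ʳ i) (x ⟨$⟩ʳ j))

2inv-cong : (x y : Permutation′ n) → x ≈ y → 2inv x ≡ 2inv y
2inv-cong x y e = ∑₂-cong λ i j → cong₂ (λ k l → δ (lt i j) (lt k l)) (e i) (e j)

Additive : Permutation′ n → Permutation′ n → Set
Additive x y = ∀ i j → i Fin.< j → y ⟨$⟩ʳ j Fin.< y ⟨$⟩ʳ i →
               x ⟨$⟩ʳ (y ⟨$⟩ʳ j) Fin.< x ⟨$⟩ʳ (y ⟨$⟩ʳ i)

undone : (x y : Permutation′ n) → Fin n → Fin n → ℕ
undone x y i j = ε (lt i j) (lt (y ⟨$⟩ʳ i) (y ⟨$⟩ʳ j))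
                   (lt (x ⟨$⟩ʳ (y ⟨$⟩ʳ i)) (x ⟨$⟩ʳ (y ⟨$⟩ʳ j)))

-- `δ-triangle` is applied to the order of each pair initially, after y and after x. Since the
-- defect is an explicit sum of naturals, it vanishes exactly when every term does, which yields
-- both directions of the additivity criterion.
2inv-· : (x y : Permutation′ n) → 2inv (x · y) + ∑₂ (undone x y) ≡ 2inv x + 2inv y
2inv-· x y = begin
  2inv (x · y) + ∑₂ (undone x y)
    ≡⟨ ∑₂-+ _ (undone x y) ⟨
  ∑₂ (λ i j → δ (lt i j) (lt (x · y ⟨$⟩ʳ i) (x · y ⟨$⟩ʳ j)) + undone x y i j)
    ≡⟨ ∑₂-cong (λ i j → δ-triangle (lt i j) (lt (y ⟨$⟩ʳ i) (y ⟨$⟩ʳ j)) _) ⟩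
  ∑₂ (λ i j → δ (lt i j) (lt (y ⟨$⟩ʳ i) (y ⟨$⟩ʳ j)) + f (y ⟨$⟩ʳ i) (y ⟨$⟩ʳ j))
    ≡⟨ ∑₂-+ _ (λ i j → f (y ⟨$⟩ʳ i) (y ⟨$⟩ʳ j)) ⟩
  2inv y + ∑₂ (λ i j → f (y ⟨$⟩ʳ i) (y ⟨$⟩ʳ j))
    ≡⟨ cong (2inv y +_) (∑₂-permute f y) ⟨
  2inv y + 2inv x
    ≡⟨ +-comm (2inv y) (2inv x) ⟩
  2inv x + 2inv y ∎
  where
  open ≡-Reasoning
  f = λ i j → δ (lt i j) (lt (x ⟨$⟩ʳ i) (x ⟨$⟩ʳ j))

additive⇒undone-0 : (x y : Permutation′ n) → Additive x y → ∀ i j → undone x y i j ≡ 0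
additive⇒undone-0 x y add i j with Fin.<-cmp i j
... | tri≈ i≮j refl _
  rewrite dec-false (i Fin.<? i) i≮j
        | dec-false (y ⟨$⟩ʳ i Fin.<? y ⟨$⟩ʳ i) (<-irrefl refl) = refl
... | tri< i<j i≢j _ rewrite dec-true (i Fin.<? j) i<j
  with Fin.<-cmp (y ⟨$⟩ʳ i) (y ⟨$⟩ʳ j)
...   | tri< yi<yj _ _ rewrite dec-true (y ⟨$⟩ʳ i Fin.<? y ⟨$⟩ʳ j) yi<yj = refl
...   | tri≈ _ yi≡yj _ = contradiction (injective y yi≡yj) i≢j
...   | tri> yi≮yj _ yj<yi
  rewrite dec-false (y ⟨$⟩ʳ i Fin.<? y ⟨$⟩ʳ j) yi≮yj
        | dec-false (x · y ⟨$⟩ʳ i Fin.<? x · y ⟨$⟩ʳ j) (<⇒≯ (add i j i<j yj<yi)) = refl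
additive⇒undone-0 x y add i j | tri> i≮j i≢j j<i rewrite dec-false (i Fin.<? j) i≮j
  with Fin.<-cmp (y ⟨$⟩ʳ i) (y ⟨$⟩ʳ j)
...   | tri> yi≮yj _ _ rewrite dec-false (y ⟨$⟩ʳ i Fin.<? y ⟨$⟩ʳ j) yi≮yj = refl
...   | tri≈ _ yi≡yj _ = contradiction (injective y yi≡yj) i≢j
...   | tri< yi<yj _ _
  rewrite dec-true (y ⟨$⟩ʳ i Fin.<? y ⟨$⟩ʳ j) yi<yj
        | dec-true (x · y ⟨$⟩ʳ i Fin.<? x · y ⟨$⟩ʳ j) (add j i j<i yi<yj) = refl

undone-0⇒additive : (x y : Permutation′ n) → (∀ i j → undone x y i j ≡ 0) → Additive x y
undone-0⇒additive x y e i j i<j yj<yi with Fin.<-cmp (x · y ⟨$⟩ʳ i) (x · y ⟨$⟩ʳ j)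
... | tri> _ _ xyj<xyi = xyj<xyi
... | tri≈ _ xyi≡xyj _ = contradiction (cong toℕ (injective (x · y) xyi≡xyj)) (<⇒≢ i<j)
... | tri< xyi<xyj _ _ = contradiction (trans (sym twice) (e i j)) λ ()
  where
  twice : undone x y i j ≡ 2
  twice rewrite dec-true (i Fin.<? j) i<j
              | dec-false (y ⟨$⟩ʳ i Fin.<? y ⟨$⟩ʳ j) (<⇒≯ yj<yi)
              | dec-true (x · y ⟨$⟩ʳ i Fin.<? x · y ⟨$⟩ʳ j) xyi<xyj = refl

additive⇒2inv : (x y : Permutation′ n) → Additive x y → 2inv (x · y) ≡ 2inv x + 2inv y
additive⇒2inv x y add = begin
  2inv (x · y)                   ≡⟨ +-identityʳ _ ⟨
  2inv (x · y) + 0               ≡⟨ cong (2inv (x · y) +_) none ⟨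
  2inv (x · y) + ∑₂ (undone x y) ≡⟨ 2inv-· x y ⟩
  2inv x + 2inv y                ∎
  where
  open ≡-Reasoning
  none : ∑₂ (undone x y) ≡ 0
  none = sum-0 (λ i → sum (undone x y i)) λ i → sum-0 (undone x y i) (additive⇒undone-0 x y add i)

2inv⇒additive : (x y : Permutation′ n) → 2inv (x · y) ≡ 2inv x + 2inv y → Additive x y
2inv⇒additive x y e = undone-0⇒additive x y λ i → sum-0⁻¹ _ (sum-0⁻¹ _ none i)
  where
  none : ∑₂ (undone x y) ≡ 0
  none = +-cancelˡ-≡ (2inv (x · y)) _ _
    (trans (2inv-· x y) (trans (sym e) (sym (+-identityʳ _))))

2inv-≤ : (x y : Permutation′ n) → 2inv (x · y) ≤ 2inv x + 2inv y
2inv-≤ x y = subst (2inv (x · y) ≤_) (2inv-· x y) (m≤m+n _ _)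

-- Classes

-- Two points of one class are joined by adjacent pairs from J, so a transitive relation need only
-- be checked on those. `f` is arbitrary so that the induction can pass to `f ∘ suc`; R is later <,
-- > and equality of classes.
chain : ∀ {a} {A : Set a} (R : A → A → Set) → Transitive R →
        (J : Subset r) (f : Fin (suc r) → A) →
        (∀ j → j ∈ J → R (f (inject₁ j)) (f (suc j))) →
        ∀ x y → class J x ≡ class J y → x Fin.< y → R (f x) (f y)
chain R tr (inside ∷ J)  f adj zero    (suc zero)    e  x<y = adj zero here
chain R tr (inside ∷ J)  f adj zero    (suc (suc y)) e  x<y = tr (adj zero here)
  (chain R tr J (f ∘ suc) (λ j → adj (suc j) ∘ there) zero (suc y) e (s≤s z≤n))
chain R tr (inside ∷ J)  f adj (suc x) (suc y)       e  (s≤s x<y) =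
  chain R tr J (f ∘ suc) (λ j → adj (suc j) ∘ there) x y e x<y
chain R tr (outside ∷ J) f adj (suc x) (suc y)       e  (s≤s x<y) =
  chain R tr J (f ∘ suc) (λ j → adj (suc j) ∘ there) x y (cong pred e) x<y

class-⊤ : (x : Fin (suc r)) → class ⊤ x ≡ 0
class-⊤         zero    = refl
class-⊤ {suc r} (suc x) = class-⊤ x

class-step⁻¹ : (J : Subset r) (j : Fin r) → class J (inject₁ j) ≡ class J (suc j) → j ∈ J
class-step⁻¹ (inside  ∷ J) zero    e = here
class-step⁻¹ (inside  ∷ J) (suc j) e = there (class-step⁻¹ J j e)
class-step⁻¹ (outside ∷ J) (suc j) e = there (class-step⁻¹ J j (cong pred e))

class-∉ : (J : Subset r) (j : Fin r) → j ∉ J → class J (suc j) ≡ suc (class J (inject₁ j))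
class-∉ (inside  ∷ J) zero    j∉ = contradiction here j∉
class-∉ (outside ∷ J) zero    j∉ = refl
class-∉ (inside  ∷ J) (suc j) j∉ = class-∉ J j (j∉ ∘ there)
class-∉ (outside ∷ J) (suc j) j∉ = cong suc (class-∉ J j (j∉ ∘ there))

class-<⇒< : (J : Subset r) (x y : Fin (suc r)) → class J x < class J y → x Fin.< y
class-<⇒< J x y c< = ≰⇒> λ y≤x → <⇒≱ c< (class-mono J y x y≤x)

-- Simple reflections

inject₁<suc : (i : Fin r) → inject₁ i Fin.< suc i
inject₁<suc i = s≤s (≤-reflexive (Fin.toℕ-inject₁ i))

inject₁≢suc : (i : Fin r) → inject₁ i ≢ suc i
inject₁≢suc i e = <⇒≢ (inject₁<suc i) (cong toℕ e)

s-inject₁ : (i : Fin r) → s i ⟨$⟩ʳ inject₁ i ≡ suc i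
s-inject₁ i rewrite dec-true (inject₁ i Fin.≟ inject₁ i) refl = refl

s-suc : (i : Fin r) → s i ⟨$⟩ʳ suc i ≡ inject₁ i
s-suc i rewrite dec-false (suc i Fin.≟ inject₁ i) (inject₁≢suc i ∘ sym)
              | dec-true (suc i Fin.≟ suc i) refl = refl

s-other : (i : Fin r) {k : Fin (suc r)} → k ≢ inject₁ i → k ≢ suc i → s i ⟨$⟩ʳ k ≡ k
s-other i {k} ≢₀ ≢₁ rewrite dec-false (k Fin.≟ inject₁ i) ≢₀
                          | dec-false (k Fin.≟ suc i) ≢₁ = refl

data Position (i : Fin r) : Fin (suc r) → Set where
  left  : Position i (inject₁ i)
  right : Position i (suc i)
  other : ∀ {k} → k ≢ inject₁ i → k ≢ suc i → Position i k

position : (i : Fin r) (k : Fin (suc r)) → Position i k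
position i k with k Fin.≟ inject₁ i | k Fin.≟ suc i
... | yes refl | _        = left
... | no _     | yes refl = right
... | no ≢₀    | no ≢₁    = other ≢₀ ≢₁

s-involutive : (i : Fin r) (k : Fin (suc r)) → s i ⟨$⟩ʳ (s i ⟨$⟩ʳ k) ≡ k
s-involutive i k with position i k
... | left        = trans (cong (s i ⟨$⟩ʳ_) (s-inject₁ i)) (s-suc i)
... | right       = trans (cong (s i ⟨$⟩ʳ_) (s-suc i)) (s-inject₁ i)
... | other ≢₀ ≢₁ = trans (cong (s i ⟨$⟩ʳ_) (s-other i ≢₀ ≢₁)) (s-other i ≢₀ ≢₁)

>inject₁⇒≥suc : (i : Fin r) {k : Fin (suc r)} → inject₁ i Fin.< k → suc i Fin.≤ k
>inject₁⇒≥suc i i<k = subst (_< _) (Fin.toℕ-inject₁ i) i<k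

<suc⇒≤inject₁ : (i : Fin r) {k : Fin (suc r)} → k Fin.< suc i → k Fin.≤ inject₁ i
<suc⇒≤inject₁ i (s≤s k≤i) = subst (_ ≤_) (sym (Fin.toℕ-inject₁ i)) k≤i

s-mono : (i : Fin r) {k l : Fin (suc r)} → k Fin.< l → ¬ (k ≡ inject₁ i × l ≡ suc i) →
         s i ⟨$⟩ʳ k Fin.< s i ⟨$⟩ʳ l
s-mono i {k} {l} k<l ≢ with position i k | position i l
... | left      | left      = contradiction refl (<⇒≢ k<l)
... | left      | right     = contradiction (refl , refl) ≢
... | left      | other ≢₀ ≢₁ rewrite s-inject₁ i | s-other i ≢₀ ≢₁ =
        ≤∧≢⇒< (>inject₁⇒≥suc i k<l) (≢₁ ∘ sym ∘ Fin.toℕ-injective)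
... | right     | left      = contradiction (inject₁<suc i) (<⇒≯ k<l)
... | right     | right     = contradiction refl (<⇒≢ k<l)
... | right     | other ≢₀ ≢₁ rewrite s-suc i | s-other i ≢₀ ≢₁ = <-trans (inject₁<suc i) k<l
... | other ≢₀ ≢₁ | left  rewrite s-inject₁ i | s-other i ≢₀ ≢₁ = <-trans k<l (inject₁<suc i)
... | other ≢₀ ≢₁ | right rewrite s-suc i | s-other i ≢₀ ≢₁ =
        ≤∧≢⇒< (<suc⇒≤inject₁ i k<l) (≢₀ ∘ Fin.toℕ-injective)
... | other ≢₀ ≢₁ | other ≢₂ ≢₃ rewrite s-other i ≢₀ ≢₁ | s-other i ≢₂ ≢₃ = k<l

s-inversion : (i : Fin r) {k l : Fin (suc r)} → k Fin.< l → s i ⟨$⟩ʳ l Fin.< s i ⟨$⟩ʳ k →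
              k ≡ inject₁ i × l ≡ suc i
s-inversion i {k} {l} k<l sl<sk =
  decidable-stable ((k Fin.≟ inject₁ i) ×-dec (l Fin.≟ suc i)) λ ≢ →
    <⇒≯ (s-mono i k<l ≢) sl<sk

-- Since `s i` is an involution, a point that it raises forms an inversion with its image. This is
-- how the index i is recovered from the permutation `s i`.
s-raises : (i : Fin r) {k : Fin (suc r)} → k Fin.< s i ⟨$⟩ʳ k → k ≡ inject₁ i × s i ⟨$⟩ʳ k ≡ suc i
s-raises i {k} k<sk =
  s-inversion i k<sk (subst (Fin._< s i ⟨$⟩ʳ k) (sym (s-involutive i k)) k<sk)

s-injective : {i j : Fin r} → s i ≈ s j → i ≡ j
s-injective {i = i} {j} e = Fin.inject₁-injective (proj₁ (s-raises j
  (subst (inject₁ i Fin.<_) (trans (sym (s-inject₁ i)) (e (inject₁ i))) (inject₁<suc i))))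

-- The single inversion is counted in both orders: for `zero`, the first two rows contribute 1 each
-- and all others vanish.
2inv-s : (i : Fin r) → 2inv (s i) ≡ 2
2inv-s {suc r} zero = cong₂ _+_
  (cong suc (sum-0 (λ j → f zero (suc (suc j))) λ _ → refl))
  (cong₂ _+_
    (cong suc (sum-0 (λ j → f (suc zero) (suc (suc j))) λ _ → refl))
    (sum-0 (λ i → sum (f (suc (suc i)))) λ i →
      sum-0 (λ j → f (suc (suc i)) (suc (suc j))) λ j → δ-refl (lt i j)))
  where
  f = λ (i j : Fin (suc (suc r))) → δ (lt i j) (lt (s zero ⟨$⟩ʳ i) (s zero ⟨$⟩ʳ j))
  δ-refl : ∀ b → δ b b ≡ 0
  δ-refl true  = refl
  δ-refl false = refl
2inv-s {suc r} (suc i) = trans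
  (2inv-cong (s (suc i)) (lift₀ (s i)) (lift₀-transpose (inject₁ i) (suc i)))
  (cong₂ _+_ (sum-0 (λ j → δ (lt zero (suc j)) (lt zero (suc (s i ⟨$⟩ʳ j)))) λ _ → refl) (2inv-s i))

-- Length

s-additiveʳ : (w : Permutation′ (suc r)) (j : Fin r) →
              w ⟨$⟩ʳ inject₁ j Fin.< w ⟨$⟩ʳ suc j → Additive w (s j)
s-additiveʳ w j asc k l k<l sl<sk with s-inversion j k<l sl<sk
... | refl , refl rewrite s-inject₁ j | s-suc j = asc

s-additiveˡ : (w : Permutation′ (suc r)) (i : Fin r) →
              w ⟨$⟩ˡ inject₁ i Fin.< w ⟨$⟩ˡ suc i → Additive (s i) w
s-additiveˡ w i asc k l k<l wl<wk = s-mono i wl<wk λ (e , f) → <⇒≯ k<l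
  (subst₂ Fin._<_ (trans (cong (w ⟨$⟩ˡ_) (sym e)) (inverseˡ w))
                  (trans (cong (w ⟨$⟩ˡ_) (sym f)) (inverseˡ w)) asc)

-- A map without descents dominates the identity; applied to w and to its
-- inverse, this forces w to be the identity.
increasing-≥ : ∀ {m} (f : Fin (suc r) → Fin m) → (∀ j → f (inject₁ j) Fin.< f (suc j)) →
               ∀ i → toℕ i ≤ toℕ (f i)
increasing-≥ f inc zero    = z≤n
increasing-≥ {suc r} f inc (suc i) =
  ≤-<-trans (increasing-≥ (f ∘ inject₁) (inc ∘ inject₁) i) (inc i)

increasing⇒id : (w : Permutation′ (suc r)) →
                (∀ j → w ⟨$⟩ʳ inject₁ j Fin.< w ⟨$⟩ʳ suc j) → w ≈ idₚ
increasing⇒id w inc i = Fin.toℕ-injective (≤-antisym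
  (subst (λ k → toℕ (w ⟨$⟩ʳ i) ≤ toℕ k) (inverseˡ w)
    (increasing-≥ (w ⟨$⟩ˡ_) inc⁻¹ (w ⟨$⟩ʳ i)))
  (increasing-≥ (w ⟨$⟩ʳ_) inc i))
  where
  inc⁻¹ : ∀ j → w ⟨$⟩ˡ inject₁ j Fin.< w ⟨$⟩ˡ suc j
  inc⁻¹ j with Fin.<-cmp (w ⟨$⟩ˡ inject₁ j) (w ⟨$⟩ˡ suc j)
  ... | tri< l _ _ = l
  ... | tri≈ _ e _ = contradiction (injective (w ⁻¹) e) (inject₁≢suc j)
  ... | tri> _ _ g = contradiction
    -- With `⊤` for J all points form one class, so `chain` extends the absence of descents from
    -- adjacent pairs to all pairs.
    (chain Fin._<_ <-trans ⊤ (w ⟨$⟩ʳ_) (λ j _ → inc j) _ _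
           (trans (class-⊤ (w ⟨$⟩ˡ suc j)) (sym (class-⊤ (w ⟨$⟩ˡ inject₁ j)))) g)
    (<⇒≯ (subst₂ Fin._<_ (sym (inverseʳ w)) (sym (inverseʳ w)) (inject₁<suc j)))

descent? : (w : Permutation′ (suc r)) →
           (∃ λ j → w ⟨$⟩ʳ suc j Fin.< w ⟨$⟩ʳ inject₁ j) ⊎ w ≈ idₚ
descent? w with Fin.any? (λ j → w ⟨$⟩ʳ suc j Fin.<? w ⟨$⟩ʳ inject₁ j)
... | yes d = inj₁ d
... | no ¬d = inj₂ (increasing⇒id w λ j →
        ≮⇒> (λ d → ¬d (j , d)) (inject₁≢suc j ∘ sym ∘ injective w))

·s-cancel : (w : Permutation′ (suc r)) (j : Fin r) → w · s j · s j ≈ w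
·s-cancel w j k = cong (w ⟨$⟩ʳ_) (s-involutive j k)

2inv-·s : (w : Permutation′ (suc r)) (j : Fin r) → w ⟨$⟩ʳ inject₁ j Fin.< w ⟨$⟩ʳ suc j →
          2inv (w · s j) ≡ 2inv w + 2
2inv-·s w j asc = trans (additive⇒2inv w (s j) (s-additiveʳ w j asc)) (cong (2inv w +_) (2inv-s j))

·s-ascent : (w : Permutation′ (suc r)) (j : Fin r) → w ⟨$⟩ʳ suc j Fin.< w ⟨$⟩ʳ inject₁ j →
            w · s j ⟨$⟩ʳ inject₁ j Fin.< w · s j ⟨$⟩ʳ suc j
·s-ascent w j desc rewrite s-inject₁ j | s-suc j = desc

2inv-eval : (u : Word r) → 2inv (eval u) ≤ length u + length u
-- The identity composes additively with itself, so `2inv idₚ` equals its own double and is 0.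
2inv-eval {r} []      = ≤-reflexive (+-cancelˡ-≡ (2inv (idₚ {suc r})) _ _
  (trans (sym (additive⇒2inv (idₚ {suc r}) idₚ λ _ _ _ g → g)) (sym (+-identityʳ _))))
2inv-eval (i ∷ u) = begin
  2inv (s i · eval u)            ≤⟨ 2inv-≤ (s i) (eval u) ⟩
  2inv (s i) + 2inv (eval u)     ≡⟨ cong (_+ 2inv (eval u)) (2inv-s i) ⟩
  2 + 2inv (eval u)              ≤⟨ s≤s (s≤s (2inv-eval u)) ⟩
  2 + (length u + length u)      ≡⟨ cong suc (+-suc (length u) (length u)) ⟨
  suc (length u) + suc (length u) ∎
  where open ≤-Reasoning

2inv-descent : (w : Permutation′ (suc r)) (j : Fin r) → w ⟨$⟩ʳ suc j Fin.< w ⟨$⟩ʳ inject₁ j →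
               2inv w ≡ 2 + 2inv (w · s j)
2inv-descent w j desc = trans (sym (2inv-cong (w · s j · s j) w (·s-cancel w j)))
  (trans (2inv-·s (w · s j) j (·s-ascent w j desc)) (+-comm (2inv (w · s j)) 2))

SortingWord : Permutation′ (suc r) → Set
SortingWord w = ∃ λ u → eval u ≈ w × length u + length u ≤ 2inv w

sortingWord-∷ʳ : (w : Permutation′ (suc r)) (j : Fin r) → w ⟨$⟩ʳ suc j Fin.< w ⟨$⟩ʳ inject₁ j →
                 SortingWord (w · s j) → SortingWord w
sortingWord-∷ʳ w j desc (u , e , len) = u ++ j ∷ [] ,
  (λ i → trans (eval-++ u (j ∷ []) i) (trans (e (s j ⟨$⟩ʳ i)) (·s-cancel w j i))) ,
  (begin
    length (u ++ j ∷ []) + length (u ++ j ∷ []) ≡⟨ cong (λ l → l + l) (length-++ u) ⟩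
    length u + 1 + (length u + 1)   ≡⟨ rearrange (length u) ⟩
    2 + (length u + length u)       ≤⟨ +-monoʳ-≤ 2 len ⟩
    2 + 2inv (w · s j)              ≡⟨ 2inv-descent w j desc ⟨
    2inv w                          ∎)
  where
  open ≤-Reasoning
  rearrange : ∀ a → a + 1 + (a + 1) ≡ 2 + (a + a)
  rearrange = solve-∀

-- Bubble sort: removing a descent lowers `2inv` by 2, so k serves as fuel, and the sorting stops at
-- the identity.
sortingWord : ∀ k (w : Permutation′ (suc r)) → 2inv w ≤ k → SortingWord w
sortingWord k       w b with descent? w
sortingWord k       w b | inj₂ e          = [] , (λ i → sym (e i)) , z≤n
sortingWord zero    w b | inj₁ (j , desc) =
  contradiction (trans (sym (n≤0⇒n≡0 b)) (2inv-descent w j desc)) λ ()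
sortingWord (suc k) w b | inj₁ (j , desc) = sortingWord-∷ʳ w j desc
  (sortingWord k (w · s j) (≤-pred (≤-trans (n≤1+n _) (subst (_≤ suc k) (2inv-descent w j desc) b))))

ℓ-minimal : (w : Permutation′ (suc r)) (u : Word r) → eval u ≈ w → ℓ w ≤ length u
ℓ-minimal w u e = proj₂ (proj₂ (minimalWord w)) u e

reducedWord-eval : (w : Permutation′ (suc r)) → eval (reducedWord w) ≈ w
reducedWord-eval w = proj₁ (proj₂ (minimalWord w))

-- Each letter of a word creates at most one inversion, which bounds every word from below; the
-- sorting word attains the bound.
ℓ-2inv : (w : Permutation′ (suc r)) → ℓ w + ℓ w ≡ 2inv w
ℓ-2inv w with sortingWord _ w ≤-refl
... | u , e , len = ≤-antisym
  (≤-trans (+-mono-≤ (ℓ-minimal w u e) (ℓ-minimal w u e)) len)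
  (subst (_≤ ℓ w + ℓ w) (2inv-cong (eval (reducedWord w)) w (reducedWord-eval w))
         (2inv-eval (reducedWord w)))

double-cancel : ∀ {a b} → a + a ≡ b + b → a ≡ b
double-cancel {a} {b} e with <-cmp a b
... | tri< l _ _ = contradiction e (<⇒≢ (+-mono-< l l))
... | tri≈ _ p _ = p
... | tri> _ _ g = contradiction (sym e) (<⇒≢ (+-mono-< g g))

ℓ-cong : (x y : Permutation′ (suc r)) → x ≈ y → ℓ x ≡ ℓ y
ℓ-cong x y e = double-cancel (trans (ℓ-2inv x) (trans (2inv-cong x y e) (sym (ℓ-2inv y))))

ℓ-sum : (x y : Permutation′ (suc r)) → ℓ x + ℓ y + (ℓ x + ℓ y) ≡ 2inv x + 2inv y
ℓ-sum x y = trans (interchange (ℓ x) (ℓ y)) (cong₂ _+_ (ℓ-2inv x) (ℓ-2inv y))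
  where
  interchange : ∀ a b → a + b + (a + b) ≡ a + a + (b + b)
  interchange = solve-∀

additive⇒ℓ : (x y : Permutation′ (suc r)) → Additive x y → ℓ (x · y) ≡ ℓ x + ℓ y
additive⇒ℓ x y add = double-cancel
  (trans (ℓ-2inv (x · y)) (trans (additive⇒2inv x y add) (sym (ℓ-sum x y))))

ℓ⇒additive : (x y : Permutation′ (suc r)) → ℓ (x · y) ≡ ℓ x + ℓ y → Additive x y
ℓ⇒additive x y e = 2inv⇒additive x y
  (trans (sym (ℓ-2inv (x · y))) (trans (cong (λ l → l + l) e) (ℓ-sum x y)))

ℓ-· : (x y : Permutation′ (suc r)) → ℓ (x · y) ≤ ℓ x + ℓ y
ℓ-· x y = subst (ℓ (x · y) ≤_)
  (length-++ (reducedWord x))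
  (ℓ-minimal (x · y) (reducedWord x ++ reducedWord y) λ i →
    trans (eval-++ (reducedWord x) (reducedWord y) i)
    (trans (reducedWord-eval x _) (cong (x ⟨$⟩ʳ_) (reducedWord-eval y i))))

ℓ-s : (i : Fin r) → ℓ (s i) ≡ 1
ℓ-s i = double-cancel (trans (ℓ-2inv (s i)) (2inv-s i))

ℓ-id : ℓ (idₚ {suc r}) ≡ 0
ℓ-id {r} = n≤0⇒n≡0 (ℓ-minimal (idₚ {suc r}) [] λ _ → refl)

ℓ-0 : (w : Permutation′ (suc r)) → ℓ w ≡ 0 → w ≈ idₚ
ℓ-0 w e i with reducedWord w | reducedWord-eval w | e
... | [] | eᵂ | _ = sym (eᵂ i)

ℓ-·s : (w : Permutation′ (suc r)) (j : Fin r) → w ⟨$⟩ʳ inject₁ j Fin.< w ⟨$⟩ʳ suc j →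
       ℓ (w · s j) ≡ suc (ℓ w)
ℓ-·s w j asc = trans (additive⇒ℓ w (s j) (s-additiveʳ w j asc))
                     (trans (cong (ℓ w +_) (ℓ-s j)) (+-comm (ℓ w) 1))

ℓ-s· : (w : Permutation′ (suc r)) (i : Fin r) → w ⟨$⟩ˡ inject₁ i Fin.< w ⟨$⟩ˡ suc i →
       ℓ (s i · w) ≡ suc (ℓ w)
ℓ-s· w i asc = trans (additive⇒ℓ (s i) w (s-additiveˡ w i asc)) (cong (_+ ℓ w) (ℓ-s i))

-- Bruhat order

≤ᴮ⇒ℓ≤ : {x y : Permutation′ (suc r)} → x ≤ᴮ y → ℓ x ≤ ℓ y
≤ᴮ⇒ℓ≤ {x = x} {y} (equal e)          = ≤-reflexive (ℓ-cong x y e)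
≤ᴮ⇒ℓ≤         (step t x≤y _ _ ℓy<ℓz) = ≤-trans (≤ᴮ⇒ℓ≤ x≤y) (<⇒≤ ℓy<ℓz)

-- Every `step` strictly raises `ℓ`, so comparability both ways leaves only `equal`.
≤ᴮ-antisym : {x y : Permutation′ (suc r)} → x ≤ᴮ y → y ≤ᴮ x → x ≈ y
≤ᴮ-antisym (equal e)               _   = e
≤ᴮ-antisym (step t x≤y _ _ ℓy<ℓz) z≤x =
  contradiction (≤-trans (≤ᴮ⇒ℓ≤ z≤x) (≤ᴮ⇒ℓ≤ x≤y)) (<⇒≱ ℓy<ℓz)

≤ᴮ-respʳ : {x y z : Permutation′ (suc r)} → x ≤ᴮ y → y ≈ z → x ≤ᴮ z
≤ᴮ-respʳ {x = x} {y} {z} (equal e) f = equal (≈-trans x y z e f)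
≤ᴮ-respʳ {x = x} {y} {z} (step {y = w} t x≤w t-refl e ℓ<) f =
  step t x≤w t-refl (λ i → trans (sym (f i)) (e i)) (subst (ℓ w <_) (ℓ-cong y z f) ℓ<)

≤ᴮ-respˡ : {x y z : Permutation′ (suc r)} → x ≈ y → y ≤ᴮ z → x ≤ᴮ z
≤ᴮ-respˡ {x = x} {y} {z} e (equal f)               = equal (≈-trans x y z e f)
≤ᴮ-respˡ                 e (step t y≤w t-refl f ℓ<) = step t (≤ᴮ-respˡ e y≤w) t-refl f ℓ<

≤ᴮ-trans : {x y z : Permutation′ (suc r)} → x ≤ᴮ y → y ≤ᴮ z → x ≤ᴮ z
≤ᴮ-trans x≤y (equal e)              = ≤ᴮ-respʳ x≤y e
≤ᴮ-trans x≤y (step t y≤w t-refl e ℓ<) = step t (≤ᴮ-trans x≤y y≤w) t-refl e ℓ<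

≤ᴮ-·s : (w : Permutation′ (suc r)) (j : Fin r) → w ⟨$⟩ʳ inject₁ j Fin.< w ⟨$⟩ʳ suc j →
        w ≤ᴮ w · s j
-- Bruhat steps multiply on the left, so the right factor `s j` is conjugated across w.
≤ᴮ-·s w j asc = step (w · s j · w ⁻¹) (equal λ _ → refl) (w , j , λ _ → refl)
  (λ i → cong (λ k → w ⟨$⟩ʳ (s j ⟨$⟩ʳ k)) (sym (inverseˡ w)))
  (≤-reflexive (sym (ℓ-·s w j asc)))

-- Parabolic subgroups

id∈W : {J : Subset r} → idₚ ∈W J
id∈W = one λ _ → refl

∈W-·s : {J : Subset r} {j : Fin r} (w : Permutation′ (suc r)) → w ∈W J → j ∈ J → (w · s j) ∈W J
∈W-·s {j = j} w w∈ j∈ = mul w (s j) w∈ (gen j j∈ λ _ → refl) λ _ → refl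

class-∈W : {J : Subset r} {w : Permutation′ (suc r)} → w ∈W J →
           ∀ k → class J (w ⟨$⟩ʳ k) ≡ class J k
class-∈W {J = J} (gen j j∈ e) k rewrite e k with position j k
... | left        rewrite s-inject₁ j         = sym (class-step j∈)
... | right       rewrite s-suc j             = class-step j∈
... | other ≢₀ ≢₁ rewrite s-other j ≢₀ ≢₁     = refl
class-∈W {J = J} (one e)           k = cong (class J) (e k)
class-∈W {J = J} (mul y z y∈ z∈ e) k =
  trans (cong (class J) (e k)) (trans (class-∈W y∈ (z ⟨$⟩ʳ k)) (class-∈W z∈ k))
class-∈W {J = J} (inv y y∈ e)      k =
  trans (cong (class J) (e k)) (trans (sym (class-∈W y∈ (y ⟨$⟩ˡ k))) (cong (class J) (inverseʳ y)))

Ascending Descending : Subset r → Permutation′ (suc r) → Set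
Ascending  J w = ∀ j → j ∈ J → w ⟨$⟩ʳ inject₁ j Fin.< w ⟨$⟩ʳ suc j
Descending J w = ∀ j → j ∈ J → w ⟨$⟩ʳ suc j Fin.< w ⟨$⟩ʳ inject₁ j

ascending-< : {J : Subset r} (w : Permutation′ (suc r)) → Ascending J w → ∀ {k l} →
              class J k ≡ class J l → k Fin.< l → w ⟨$⟩ʳ k Fin.< w ⟨$⟩ʳ l
ascending-< {J = J} w asc = chain Fin._<_ <-trans J (w ⟨$⟩ʳ_) asc _ _

descending-> : {J : Subset r} (w : Permutation′ (suc r)) → Descending J w → ∀ {k l} →
               class J k ≡ class J l → k Fin.< l → w ⟨$⟩ʳ l Fin.< w ⟨$⟩ʳ k
descending-> {J = J} w desc = chain Fin._>_ (λ p q → <-trans q p) J (w ⟨$⟩ʳ_) desc _ _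

descending-≥ : {J : Subset r} (w : Permutation′ (suc r)) → Descending J w → ∀ {k l} →
               class J k ≡ class J l → k Fin.≤ l → w ⟨$⟩ʳ l Fin.≤ w ⟨$⟩ʳ k
descending-≥ w desc {k} {l} e k≤l with k Fin.≟ l
... | yes refl = ≤-refl
... | no k≢l   = <⇒≤ (descending-> w desc e (≤∧≢⇒< k≤l (k≢l ∘ Fin.toℕ-injective)))

-- Inside a class there is no descent by assumption, and at a boundary between classes there is none
-- because the classes stay in place.
class-preserving∧ascending⇒id : {J : Subset r} (w : Permutation′ (suc r)) →
  (∀ k → class J (w ⟨$⟩ʳ k) ≡ class J k) → Ascending J w → w ≈ idₚ
class-preserving∧ascending⇒id {J = J} w pres asc = increasing⇒id w inc
  where
  inc : ∀ j → w ⟨$⟩ʳ inject₁ j Fin.< w ⟨$⟩ʳ suc j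
  inc j with j ∈? J
  ... | yes j∈ = asc j j∈
  ... | no j∉  = class-<⇒< J _ _ (subst₂ _<_ (sym (pres (inject₁ j))) (sym (pres (suc j)))
                   (≤-reflexive (sym (class-∉ J j j∉))))

-- An inversion of v ∈ W_J lies within one class, because v preserves classes and they are ordered
-- intervals; y is increasing there and cannot undo it.
ascending-additive : {J : Subset r} (y v : Permutation′ (suc r)) →
                     Ascending J y → v ∈W J → Additive y v
ascending-additive {J = J} y v asc v∈ i j i<j vj<vi =
  ascending-< y asc (trans (class-∈W v∈ j) (trans (sym same) (sym (class-∈W v∈ i)))) vj<vi
  where
  same : class J i ≡ class J j
  same = ≤-antisym (class-mono J i j (<⇒≤ i<j))
    (subst₂ _≤_ (class-∈W v∈ j) (class-∈W v∈ i)
      (class-mono J (v ⟨$⟩ʳ j) (v ⟨$⟩ʳ i) (<⇒≤ vj<vi)))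

ascending-·-ascent : {J : Subset r} {j : Fin r} (y v : Permutation′ (suc r)) →
  Ascending J y → v ∈W J → j ∈ J → v ⟨$⟩ʳ inject₁ j Fin.< v ⟨$⟩ʳ suc j →
  y · v ⟨$⟩ʳ inject₁ j Fin.< y · v ⟨$⟩ʳ suc j
ascending-·-ascent {j = j} y v asc v∈ j∈ = ascending-< y asc
  (trans (class-∈W v∈ (inject₁ j)) (trans (class-step j∈) (sym (class-∈W v∈ (suc j)))))

ascent-or-descending : (J : Subset r) (w : Permutation′ (suc r)) →
  (∃ λ j → j ∈ J × w ⟨$⟩ʳ inject₁ j Fin.< w ⟨$⟩ʳ suc j) ⊎ Descending J w
ascent-or-descending J w
  with Fin.any? (λ j → (j ∈? J) ×-dec (w ⟨$⟩ʳ inject₁ j Fin.<? w ⟨$⟩ʳ suc j))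
... | yes a = inj₁ a
... | no ¬a = inj₂ λ j j∈ → ≮⇒> (λ a → ¬a (j , j∈ , a)) (inject₁≢suc j ∘ injective w)

descent-or-ascending : (J : Subset r) (w : Permutation′ (suc r)) →
  (∃ λ j → j ∈ J × w ⟨$⟩ʳ suc j Fin.< w ⟨$⟩ʳ inject₁ j) ⊎ Ascending J w
descent-or-ascending J w
  with Fin.any? (λ j → (j ∈? J) ×-dec (w ⟨$⟩ʳ suc j Fin.<? w ⟨$⟩ʳ inject₁ j))
... | yes d = inj₁ d
... | no ¬d = inj₂ λ j j∈ → ≮⇒> (λ d → ¬d (j , j∈ , d)) (inject₁≢suc j ∘ sym ∘ injective w)

ℓ-descent : (w : Permutation′ (suc r)) (j : Fin r) → w ⟨$⟩ʳ suc j Fin.< w ⟨$⟩ʳ inject₁ j →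
            ℓ w ≡ suc (ℓ (w · s j))
ℓ-descent w j desc = trans (sym (ℓ-cong (w · s j · s j) w (·s-cancel w j)))
                           (ℓ-·s (w · s j) j (·s-ascent w j desc))

-- Descents of v inside J are stripped off one at a time, each a Bruhat step for y · v. When none is
-- left, v is the identity.
ascending-≤ᴮ : {J : Subset r} (y v : Permutation′ (suc r)) →
               Ascending J y → v ∈W J → y ≤ᴮ y · v
ascending-≤ᴮ {r} {J} y v asc v∈ = go (ℓ v) v v∈ ≤-refl (descent-or-ascending J v)
  where
  go : ∀ k (v : Permutation′ (suc r)) → v ∈W J → ℓ v ≤ k →
       (∃ λ j → j ∈ J × v ⟨$⟩ʳ suc j Fin.< v ⟨$⟩ʳ inject₁ j) ⊎ Ascending J v → y ≤ᴮ y · v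
  go k v v∈ b (inj₂ asc) = equal λ i →
    cong (y ⟨$⟩ʳ_) (sym (class-preserving∧ascending⇒id v (class-∈W v∈) asc i))
  go zero v v∈ b (inj₁ (j , _ , desc)) = contradiction (subst (_≤ 0) (ℓ-descent v j desc) b) λ ()
  go (suc k) v v∈ b (inj₁ (j , j∈ , desc)) = ≤ᴮ-respʳ
    (≤ᴮ-trans (go k (v · s j) (∈W-·s v v∈ j∈) (≤-pred (subst (_≤ suc k) (ℓ-descent v j desc) b))
                  (descent-or-ascending J (v · s j)))
              (≤ᴮ-·s (y · (v · s j)) j
                (ascending-·-ascent y (v · s j) asc (∈W-·s v v∈ j∈) j∈ (·s-ascent v j desc))))
    (·-congˡ y (v · s j · s j) v (·s-cancel v j))

reverse-> : {k l : Fin n} → k Fin.< l → reverse ⟨$⟩ʳ l Fin.< reverse ⟨$⟩ʳ k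
reverse-> {n} {k} {l} k<l rewrite Fin.opposite-prop k | Fin.opposite-prop l =
  ∸-monoʳ-< (s≤s k<l) (Fin.toℕ<n l)

-- The number of non-inversions of v, that is ℓ (reverse · v), bounds the search.
≤ᴮ-descending : {J : Subset r} (y v : Permutation′ (suc r)) → Ascending J y → v ∈W J →
                ∃ λ w → w ∈W J × Descending J w × y · v ≤ᴮ y · w
≤ᴮ-descending {r} {J} y v asc v∈ =
  go (ℓ (reverse · v)) v v∈ ≤-refl (ascent-or-descending J v)
  where
  go : ∀ k (v : Permutation′ (suc r)) → v ∈W J → ℓ (reverse · v) ≤ k →
       (∃ λ j → j ∈ J × v ⟨$⟩ʳ inject₁ j Fin.< v ⟨$⟩ʳ suc j) ⊎ Descending J v →
       ∃ λ w → w ∈W J × Descending J w × y · v ≤ᴮ y · w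
  go k v v∈ b (inj₂ desc) = v , v∈ , desc , equal λ _ → refl
  go zero v v∈ b (inj₁ (j , _ , vj<vj+1)) =
    contradiction (subst (_≤ 0) (ℓ-descent (reverse · v) j (reverse-> vj<vj+1)) b) λ ()
  go (suc k) v v∈ b (inj₁ (j , j∈ , vj<vj+1)) =
    let b′ = ≤-pred (subst (_≤ suc k) (ℓ-descent (reverse · v) j (reverse-> vj<vj+1)) b)
        (w , w∈ , desc , vs≤w) =
          go k (v · s j) (∈W-·s v v∈ j∈) b′ (ascent-or-descending J (v · s j))
    in w , w∈ , desc ,
       ≤ᴮ-trans (≤ᴮ-·s (y · v) j (ascending-·-ascent y v asc v∈ j∈ vj<vj+1)) vs≤w

-- Longest elements

-- Two reversals of a class compose to an increasing map of it. Both the uniqueness of w_J and w_J²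
-- = 1 come from this.
descending-·-id : {J : Subset r} (v w : Permutation′ (suc r)) → v ∈W J → w ∈W J →
                  Descending J v → Descending J w → v · w ≈ idₚ
descending-·-id v w v∈ w∈ v-desc w-desc = class-preserving∧ascending⇒id (v · w)
  (λ k → trans (class-∈W v∈ (w ⟨$⟩ʳ k)) (class-∈W w∈ k))
  (λ j j∈ → descending-> v v-desc
    (trans (class-∈W w∈ (suc j)) (trans (sym (class-step j∈)) (sym (class-∈W w∈ (inject₁ j)))))
    (w-desc j j∈))

descending-unique : {J : Subset r} (v w : Permutation′ (suc r)) → v ∈W J → w ∈W J →
                    Descending J v → Descending J w → v ≈ w
descending-unique v w v∈ w∈ v-desc w-desc i =
  trans (cong (v ⟨$⟩ʳ_) (sym (descending-·-id w w w∈ w∈ w-desc w-desc i)))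
        (descending-·-id v w v∈ w∈ v-desc w-desc (w ⟨$⟩ʳ i))

longest⇒descending : {J : Subset r} {w : Permutation′ (suc r)} → IsLongest J w → Descending J w
longest⇒descending {w = w} (w∈ , longest) j j∈ = ≮⇒>
  (λ asc → 1+n≰n (subst (_≤ ℓ w) (ℓ-·s w j asc) (longest (w · s j) (∈W-·s w w∈ j∈))))
  (inject₁≢suc j ∘ injective w)

ascending-id : {J : Subset r} → Ascending J idₚ
ascending-id j _ = inject₁<suc j

-- Every element of W_J lies below a descending one, and there is only one of those.
descending⇒longest : {J : Subset r} {w : Permutation′ (suc r)} →
                     w ∈W J → Descending J w → IsLongest J w
descending⇒longest {J = J} {w} w∈ desc = w∈ , λ x x∈ →
  let (v , v∈ , v-desc , x≤v) = ≤ᴮ-descending idₚ x ascending-id x∈ in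
  ≤-trans (≤ᴮ⇒ℓ≤ {x = x} {v} (≤ᴮ-respʳ (≤ᴮ-respˡ (λ _ → refl) x≤v) λ _ → refl))
          (≤-reflexive (ℓ-cong v w (descending-unique v w v∈ w∈ v-desc desc)))

longest : (J : Subset r) → ∃ λ w → IsLongest J w
longest J = let (w , w∈ , desc , _) = ≤ᴮ-descending idₚ idₚ ascending-id id∈W in
  w , descending⇒longest w∈ desc

longest-involutive : {J : Subset r} {w : Permutation′ (suc r)} → IsLongest J w → w · w ≈ idₚ
longest-involutive {w = w} L@(w∈ , _) =
  descending-·-id w w w∈ w∈ (longest⇒descending L) (longest⇒descending L)

longest-unique : {J : Subset r} {v w : Permutation′ (suc r)} →
                 IsLongest J v → IsLongest J w → v ≈ w
longest-unique {v = v} {w} V@(v∈ , _) W@(w∈ , _) =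
  descending-unique v w v∈ w∈ (longest⇒descending V) (longest⇒descending W)

covering : {k l : Fin (suc r)} → k Fin.< l →
           (∀ (m : Fin (suc r)) → k Fin.< m → ¬ m Fin.< l) →
           ∃ λ i → k ≡ inject₁ i × l ≡ suc i
covering {l = suc i} k<l between = i , Fin.toℕ-injective (≤-antisym (<suc⇒≤inject₁ i k<l)
  (≮⇒≥ λ k<i → between (inject₁ i) k<i (inject₁<suc i))) , refl

-- A point strictly between the images of j + 1 and j would be sent by the involution w strictly
-- between j and j + 1. So the images are adjacent.
longest-flips : {J : Subset r} {w : Permutation′ (suc r)} → IsLongest J w → ∀ j → j ∈ J →
                ∃ λ i → i ∈ J × w ⟨$⟩ʳ inject₁ j ≡ suc i × w ⟨$⟩ʳ suc j ≡ inject₁ i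
longest-flips {J = J} {w} L@(w∈ , _) j j∈ =
  let (i , e₀ , e₁) = covering (desc j j∈) between in
  i , class-step⁻¹ J i (trans (cong (class J) (sym e₀))
        (trans same (cong (class J) e₁))) , e₁ , e₀
  where
  desc = longest⇒descending L
  same : class J (w ⟨$⟩ʳ suc j) ≡ class J (w ⟨$⟩ʳ inject₁ j)
  same = trans (class-∈W w∈ (suc j)) (trans (sym (class-step j∈)) (sym (class-∈W w∈ (inject₁ j))))
  between : ∀ m → w ⟨$⟩ʳ suc j Fin.< m → ¬ m Fin.< w ⟨$⟩ʳ inject₁ j
  between m lo hi = <⇒≱
    (subst (w ⟨$⟩ʳ m Fin.<_) (longest-involutive L (suc j)) (descending-> w desc (sym same₁) lo))
    (>inject₁⇒≥suc j (subst (Fin._< w ⟨$⟩ʳ m) (longest-involutive L (inject₁ j))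
      (descending-> w desc (trans same₁ same) hi)))
    where
    same₁ : class J m ≡ class J (w ⟨$⟩ʳ suc j)
    same₁ = ≤-antisym
      (≤-trans (class-mono J _ _ (<⇒≤ hi)) (≤-reflexive (sym same)))
      (class-mono J _ _ (<⇒≤ lo))

-- Block permutations

Shifts : Permutation′ (suc r) → Fin r → Fin r → Set
Shifts y j i = y ⟨$⟩ʳ inject₁ j ≡ inject₁ i × y ⟨$⟩ʳ suc j ≡ suc i

-- A local form of block permutation: the first half makes y map each J-class in order and without
-- gaps into an I-class, the second makes the image fill that class. Stated on adjacent pairs, it
-- matches the conjugation I = y J y⁻¹ generator by generator.
IsBlock : Subset r → Subset r → Permutation′ (suc r) → Set
IsBlock I J y = (∀ j → j ∈ J → ∃ λ i → i ∈ I × Shifts y j i)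
              × (∀ i → i ∈ I → ∃ λ j → j ∈ J × Shifts y j i)

block-id : {I : Subset r} → IsBlock I I idₚ
block-id = (λ j j∈ → j , j∈ , refl , refl) , (λ j j∈ → j , j∈ , refl , refl)

block-· : {I J K : Subset r} (x y : Permutation′ (suc r)) →
          IsBlock I J x → IsBlock J K y → IsBlock I K (x · y)
block-· x y (x→ , x←) (y→ , y←) =
  (λ k k∈ → let (j , j∈ , e , f) = y→ k k∈ ; (i , i∈ , e′ , f′) = x→ j j∈ in
    i , i∈ , trans (cong (x ⟨$⟩ʳ_) e) e′ , trans (cong (x ⟨$⟩ʳ_) f) f′) ,
  (λ i i∈ → let (j , j∈ , e′ , f′) = x← i i∈ ; (k , k∈ , e , f) = y← j j∈ in
    k , k∈ , trans (cong (x ⟨$⟩ʳ_) e) e′ , trans (cong (x ⟨$⟩ʳ_) f) f′)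

shifts-⁻¹ : (y : Permutation′ (suc r)) {i j : Fin r} → Shifts y j i → Shifts (y ⁻¹) i j
shifts-⁻¹ y (e , f) = trans (cong (y ⟨$⟩ˡ_) (sym e)) (inverseˡ y) ,
                      trans (cong (y ⟨$⟩ˡ_) (sym f)) (inverseˡ y)

block-⁻¹ : {I J : Subset r} (y : Permutation′ (suc r)) → IsBlock I J y → IsBlock J I (y ⁻¹)
block-⁻¹ y (y→ , y←) =
  (λ i i∈ → let (j , j∈ , sh) = y← i i∈ in j , j∈ , shifts-⁻¹ y sh) ,
  (λ j j∈ → let (i , i∈ , sh) = y→ j j∈ in i , i∈ , shifts-⁻¹ y sh)

block-ascending : {I J : Subset r} (y : Permutation′ (suc r)) → IsBlock I J y → Ascending J y
block-ascending y (y→ , _) j j∈ with y→ j j∈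
... | i , _ , e , f = subst₂ Fin._<_ (sym e) (sym f) (inject₁<suc i)

shifts-conj : (y : Permutation′ (suc r)) {i j : Fin r} → Shifts y j i →
              s i ≈ y · s j · y ⁻¹
shifts-conj y {i} {j} (e , f) k =
  subst (λ k → s i ⟨$⟩ʳ k ≡ y ⟨$⟩ʳ (s j ⟨$⟩ʳ (y ⟨$⟩ˡ k))) (inverseʳ y) (go (y ⟨$⟩ˡ k))
  where
  go : ∀ l → s i ⟨$⟩ʳ (y ⟨$⟩ʳ l) ≡ y ⟨$⟩ʳ (s j ⟨$⟩ʳ (y ⟨$⟩ˡ (y ⟨$⟩ʳ l)))
  go l rewrite inverseˡ y {l} with position j l
  ... | left rewrite e | s-inject₁ i | s-inject₁ j = sym f
  ... | right rewrite f | s-suc i | s-suc j = sym e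
  ... | other ≢₀ ≢₁ rewrite s-other j ≢₀ ≢₁ =
    s-other i (λ g → ≢₀ (injective y (trans g (sym e)))) (λ g → ≢₁ (injective y (trans g (sym f))))

-- The conjugate of `s j` exchanges the images of j and j + 1, so these are the two points moved by
-- `s i`; the ascent tells which is the lower.
conj-shifts : (y : Permutation′ (suc r)) {i j : Fin r} → y ⟨$⟩ʳ inject₁ j Fin.< y ⟨$⟩ʳ suc j →
              s i ≈ y · s j · y ⁻¹ → Shifts y j i
conj-shifts y {i} {j} asc e = let (p , q) = s-raises i (subst (_ Fin.<_) (sym eval-s) asc) in
  p , trans (sym eval-s) q
  where
  eval-s : s i ⟨$⟩ʳ (y ⟨$⟩ʳ inject₁ j) ≡ y ⟨$⟩ʳ suc j
  eval-s = trans (e (y ⟨$⟩ʳ inject₁ j)) (cong (y ⟨$⟩ʳ_)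
    (trans (cong (s j ⟨$⟩ʳ_) (inverseˡ y)) (s-inject₁ j)))

block⇒conjugate : {I J : Subset r} (y : Permutation′ (suc r)) → IsBlock I J y → IsConjugate I y J
block⇒conjugate y (y→ , y←) =
  (λ i i∈ → let (j , j∈ , sh) = y← i i∈ in j , j∈ , shifts-conj y sh) ,
  (λ j j∈ → let (i , i∈ , sh) = y→ j j∈ in i , i∈ , shifts-conj y sh)

conjugate⇒block : {I J : Subset r} (y : Permutation′ (suc r)) → Ascending J y →
                  IsConjugate I y J → IsBlock I J y
conjugate⇒block y asc (c← , c→) =
  (λ j j∈ → let (i , i∈ , e) = c→ j j∈ in i , i∈ , conj-shifts y (asc j j∈) e) ,
  (λ i i∈ → let (j , j∈ , e) = c← i i∈ in j , j∈ , conj-shifts y (asc j j∈) e)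

-- Since y⁻¹ W_I y = W_J, the double coset of a block permutation y is y W_J.
block-conj∈W : {I J : Subset r} (y : Permutation′ (suc r)) → IsBlock I J y →
               {u : Permutation′ (suc r)} → u ∈W I → (y ⁻¹ · u · y) ∈W J
block-conj∈W y B@(y→ , y←) {u} (gen i i∈ e) =
  let (j , j∈ , sh) = y← i i∈ in
  gen j j∈ λ k → trans (cong (y ⟨$⟩ˡ_) (e (y ⟨$⟩ʳ k))) (sym (shifts-conj (y ⁻¹) (shifts-⁻¹ y sh) k))
block-conj∈W y B (one e) = one λ k → trans (cong (y ⟨$⟩ˡ_) (e (y ⟨$⟩ʳ k))) (inverseˡ y)
block-conj∈W y B {u} (mul v w v∈ w∈ e) =
  mul (y ⁻¹ · v · y) (y ⁻¹ · w · y) (block-conj∈W y B v∈) (block-conj∈W y B w∈)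
    λ k → cong (y ⟨$⟩ˡ_) (trans (e (y ⟨$⟩ʳ k)) (cong (v ⟨$⟩ʳ_) (sym (inverseʳ y))))
block-conj∈W y B {u} (inv v v∈ e) =
  inv (y ⁻¹ · v · y) (block-conj∈W y B v∈) λ k → cong (y ⟨$⟩ˡ_) (e (y ⟨$⟩ʳ k))

block-coset : {I J : Subset r} (y : Permutation′ (suc r)) → IsBlock I J y →
              ∀ z → z ∼⟨ I , J ⟩ y → ∃ λ v → v ∈W J × z ≈ y · v
block-coset y B z (u , v , u∈ , v∈ , e) =
  y ⁻¹ · u · y · v , mul (y ⁻¹ · u · y) v (block-conj∈W y B u∈) v∈ (λ _ → refl) ,
  λ k → trans (e k) (sym (inverseʳ y))

·∈W-∼ : {I J : Subset r} (y v : Permutation′ (suc r)) → v ∈W J → y · v ∼⟨ I , J ⟩ y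
·∈W-∼ y v v∈ = idₚ , v , id∈W , v∈ , λ _ → refl

≈⇒∼ : {I J : Subset r} (x y : Permutation′ (suc r)) → x ≈ y → x ∼⟨ I , J ⟩ y
≈⇒∼ x y e = idₚ , idₚ , id∈W , id∈W , e

block-minimal : {I J : Subset r} (p : Coset I J) (y : Permutation′ (suc r)) → IsBlock I J y →
                y ∼⟨ I , J ⟩ p → IsMinimal I J p y
block-minimal p y B y∼p = y∼p , λ z z∼p →
  let (v , v∈ , e) = block-coset y B z (∼-trans z p y z∼p (∼-sym y p y∼p)) in
  ≤ᴮ-respʳ (ascending-≤ᴮ y v (block-ascending y B) v∈) (≈-sym z (y · v) e)

block-maximal : {I J : Subset r} (p : Coset I J) (y w : Permutation′ (suc r)) → IsBlock I J y →
                y ∼⟨ I , J ⟩ p → IsLongest J w → IsMaximal I J p (y · w)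
block-maximal p y w B y∼p L@(w∈ , _) = ∼-trans (y · w) y p (·∈W-∼ y w w∈) y∼p , λ z z∼p →
  let (v , v∈ , e)            = block-coset y B z (∼-trans z p y z∼p (∼-sym y p y∼p))
      (x , x∈ , desc , yv≤yx) = ≤ᴮ-descending y v (block-ascending y B) v∈
  in ≤ᴮ-respˡ e (≤ᴮ-respʳ yv≤yx
       (·-congˡ y x w (descending-unique x w x∈ w∈ desc (longest⇒descending L))))

minimal-unique : {I J : Subset r} (p q : Coset I J) {x y : Permutation′ (suc r)} →
                 IsMinimal I J p x → IsMinimal I J q y → p ∼⟨ I , J ⟩ q → x ≈ y
minimal-unique p q {x} {y} (x∼p , x-min) (y∼q , y-min) p∼q = ≤ᴮ-antisym
  (x-min y (∼-trans y q p y∼q (∼-sym p q p∼q))) (y-min x (∼-trans x p q x∼p p∼q))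

maximal-unique : {I J : Subset r} (p : Coset I J) {x y : Permutation′ (suc r)} →
                 IsMaximal I J p x → IsMaximal I J p y → x ≈ y
maximal-unique p {x} {y} (x∼p , x-max) (y∼p , y-max) = ≤ᴮ-antisym (y-max x x∼p) (x-max y y∼p)

-- A descent of y at j ∈ J would make y · s j a shorter element of the same coset.
minimal-ascending : {I J : Subset r} (p : Coset I J) (y : Permutation′ (suc r)) →
                    IsMinimal I J p y → Ascending J y
minimal-ascending p y (y∼p , y-min) j j∈ = ≮⇒>
  (λ desc → 1+n≰n (subst (_≤ ℓ (y · s j)) (ℓ-descent y j desc) (≤ᴮ⇒ℓ≤
    (y-min (y · s j) (∼-trans (y · s j) y p (·∈W-∼ y (s j) (gen j j∈ λ _ → refl)) y∼p)))))
  (inject₁≢suc j ∘ sym ∘ injective y)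

core⇒block : {I J : Subset r} (p : Coset I J) ((y , _) : IsCore I J p) → IsBlock I J y
core⇒block p (y , y-min , conj) = conjugate⇒block y (minimal-ascending p y y-min) conj

block⇒core : {I J : Subset r} (y : Permutation′ (suc r)) → IsBlock I J y → IsCore I J y
block⇒core y B = y , block-minimal y y B (∼-refl y) , block⇒conjugate y B

-- 0-Hecke products

-- `_*ₛ_` tests the given representative w, while inductions know w only up to `≈`; the test
-- transfers because `ℓ` respects `≈`.
*ₛ-up : (i : Fin r) (w w′ : Permutation′ (suc r)) → w ≈ w′ → ℓ w′ < ℓ (s i · w′) →
        i *ₛ w ≈ s i · w′
*ₛ-up i w w′ e ℓ< = ≈-trans (i *ₛ w) (s i · w) (s i · w′)
  (λ k → cong (λ b → (if b then s i · w else w) ⟨$⟩ʳ k)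
    (dec-true (ℓ w <? ℓ (s i · w))
      (subst₂ _<_ (sym (ℓ-cong w w′ e)) (sym (ℓ-cong (s i · w) (s i · w′) (·-congˡ (s i) w w′ e))) ℓ<)))
  (·-congˡ (s i) w w′ e)

*ₛ-stay : (i : Fin r) (w w′ : Permutation′ (suc r)) → w ≈ w′ → ℓ (s i · w′) ≤ ℓ w′ →
          i *ₛ w ≈ w′
*ₛ-stay i w w′ e ℓ≤ = ≈-trans (i *ₛ w) w w′
  (λ k → cong (λ b → (if b then s i · w else w) ⟨$⟩ʳ k)
    (dec-false (ℓ w <? ℓ (s i · w))
      (≤⇒≯ (subst₂ _≤_ (sym (ℓ-cong (s i · w) (s i · w′) (·-congˡ (s i) w w′ e)))
                       (sym (ℓ-cong w w′ e)) ℓ≤))))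
  e

ℓ-s·≤ : (i : Fin r) (w : Permutation′ (suc r)) → ℓ (s i · w) ≤ suc (ℓ w)
ℓ-s·≤ i w = subst (λ l → ℓ (s i · w) ≤ l + ℓ w) (ℓ-s i) (ℓ-· (s i) w)

s·-cancel : (i : Fin r) (w : Permutation′ (suc r)) → s i · (s i · w) ≈ w
s·-cancel i w k = s-involutive i (w ⟨$⟩ʳ k)

ℓ≤-s· : (i : Fin r) (w : Permutation′ (suc r)) → ℓ w ≤ suc (ℓ (s i · w))
ℓ≤-s· i w = subst (_≤ suc (ℓ (s i · w))) (ℓ-cong (s i · (s i · w)) w (s·-cancel i w))
                  (ℓ-s·≤ i (s i · w))

ℓ-s·-descent : (w : Permutation′ (suc r)) (i : Fin r) → w ⟨$⟩ˡ suc i Fin.< w ⟨$⟩ˡ inject₁ i →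
               ℓ w ≡ suc (ℓ (s i · w))
ℓ-s·-descent w i desc = trans (sym (ℓ-cong (s i · (s i · w)) w (s·-cancel i w)))
  (ℓ-s· (s i · w) i (subst₂ Fin._<_
    (cong (w ⟨$⟩ˡ_) (trans (sym (inverseˡ (s i))) (cong (s i ⟨$⟩ˡ_) (s-suc i))))
    (cong (w ⟨$⟩ˡ_) (trans (sym (inverseˡ (s i))) (cong (s i ⟨$⟩ˡ_) (s-inject₁ i)))) desc))

ascent-or-descent : (w : Permutation′ (suc r)) (j : Fin r) →
  w ⟨$⟩ʳ inject₁ j Fin.< w ⟨$⟩ʳ suc j ⊎ w ⟨$⟩ʳ suc j Fin.< w ⟨$⟩ʳ inject₁ j
ascent-or-descent w j with Fin.<-cmp (w ⟨$⟩ʳ inject₁ j) (w ⟨$⟩ʳ suc j)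
... | tri< asc _ _  = inj₁ asc
... | tri≈ _ e _    = contradiction (injective w e) (inject₁≢suc j)
... | tri> _ _ desc = inj₂ desc

-- The only pair reversed by `s i` is (i, i + 1), so x stays increasing on classes unless it carries
-- a pair of J there.
s·-ascending : {J : Subset r} (i : Fin r) (x : Permutation′ (suc r)) → Ascending J x →
               (∀ j → j ∈ J → ¬ Shifts x j i) → Ascending J (s i · x)
s·-ascending i x asc ¬sh j j∈ = s-mono i (asc j j∈) (¬sh j j∈)

-- By Deodhar's lemma the first letter s i of the word either shortens x, or
-- passes through x to a letter s j of v ∈ W_J, which q absorbs.
star : {J : Subset r} (u : Word r) (x v q : Permutation′ (suc r)) →
       Ascending J x → v ∈W J → (∀ j → j ∈ J → ℓ (s j · q) ≤ ℓ q) → ℓ (x · q) ≡ ℓ x + ℓ q →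
       eval u ≈ x · v → length u ≤ ℓ x + ℓ v → foldr _*ₛ_ q u ≈ x · q
-- Here x · v is the identity and lengths add, so x has length 0.
star {r} [] x v q asc v∈ q-max ℓxq e len k = sym (ℓ-0 x (m+n≡0⇒m≡0 (ℓ x)
  (trans (sym (additive⇒ℓ x v (ascending-additive x v asc v∈)))
    (trans (sym (ℓ-cong idₚ (x · v) e)) (ℓ-id {r})))) (q ⟨$⟩ʳ k))
star {r} {J} (i ∷ u) x v q asc v∈ q-max ℓxq e len =
  [ (λ asc-i → [ absorb , (λ ¬sh → contradiction (too-long asc-i ¬sh) (<⇒≱ len)) ]′ (toSum shift?))
  , shorten ]′ (ascent-or-descent (x ⁻¹) i)
  where
  x′ = s i · x
  e′ : eval u ≈ x′ · v
  e′ k = trans (sym (s·-cancel i (eval u) k)) (cong (s i ⟨$⟩ʳ_) (e k))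

  shorten : x ⟨$⟩ˡ suc i Fin.< x ⟨$⟩ˡ inject₁ i → foldr _*ₛ_ q (i ∷ u) ≈ x · q
  shorten desc = ≈-trans (i *ₛ foldr _*ₛ_ q u) (s i · (x′ · q)) (x · q)
    (*ₛ-up i (foldr _*ₛ_ q u) (x′ · q)
      (star u x′ v q
        -- A pair of J carried to (i, i + 1) would be an ascent of x⁻¹ at i, against `desc`.
        (s·-ascending i x asc λ j _ (f , g) → <⇒≯ (inject₁<suc j) (subst₂ Fin._<_
          (trans (cong (x ⟨$⟩ˡ_) (sym g)) (inverseˡ x))
          (trans (cong (x ⟨$⟩ˡ_) (sym f)) (inverseˡ x)) desc))
        v∈ q-max ℓx′q e′ (≤-pred (subst (λ l → suc (length u) ≤ l + ℓ v) ℓx len)))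
      (≤-reflexive (trans (cong suc ℓx′q) (trans (sym ℓxq′)
        (ℓ-cong (x · q) (s i · (x′ · q)) λ k → sym (s·-cancel i (x · q) k))))))
    (s·-cancel i (x · q))
    where
    ℓx : ℓ x ≡ suc (ℓ x′)
    ℓx = ℓ-s·-descent x i desc
    ℓxq′ : ℓ (x · q) ≡ suc (ℓ x′ + ℓ q)
    ℓxq′ = trans ℓxq (cong (_+ ℓ q) ℓx)
    ℓx′q : ℓ (x′ · q) ≡ ℓ x′ + ℓ q
    -- A simple reflection changes length by at most one, so additivity for x · q leaves no slack
    -- for x′ · q.
    ℓx′q = ≤-antisym (ℓ-· x′ q) (≤-pred (subst (_≤ suc (ℓ (x′ · q))) ℓxq′ (ℓ≤-s· i (x · q))))

  shift? : Dec (∃ λ j → j ∈ J × Shifts x j i)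
  shift? = Fin.any? λ j → (j ∈? J) ×-dec
    ((x ⟨$⟩ʳ inject₁ j Fin.≟ inject₁ i) ×-dec (x ⟨$⟩ʳ suc j Fin.≟ suc i))

  -- Otherwise s i · x would be increasing on J-classes and longer than x, so (s i · x) · v would
  -- have length ℓ x + ℓ v + 1; yet u evaluates to it and is shorter by at least 2.
  too-long : x ⟨$⟩ˡ inject₁ i Fin.< x ⟨$⟩ˡ suc i →
             ¬ (∃ λ j → j ∈ J × Shifts x j i) → ℓ x + ℓ v ≤ length u
  too-long asc-i ¬sh = ≤-trans (n≤1+n _) (subst (_≤ length u)
    (trans (additive⇒ℓ x′ v (ascending-additive x′ v
             (s·-ascending i x asc λ j j∈ sh → ¬sh (j , j∈ , sh)) v∈))
           (cong (_+ ℓ v) (ℓ-s· x i asc-i)))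
    (ℓ-minimal (x′ · v) u e′))

  absorb : (∃ λ j → j ∈ J × Shifts x j i) → foldr _*ₛ_ q (i ∷ u) ≈ x · q
  absorb (j , j∈ , sh) = *ₛ-stay i (foldr _*ₛ_ q u) (x · q)
    -- The letter passes through x and is charged to v, whose length drops by at most one, so the
    -- bound on the word persists.
    (star u x (s j · v) q asc (mul (s j) v (gen j j∈ λ _ → refl) v∈ λ _ → refl) q-max ℓxq
      (λ k → trans (e′ k) (commute (v ⟨$⟩ʳ k)))
      (≤-pred (≤-trans len (subst (ℓ x + ℓ v ≤_) (+-suc (ℓ x) (ℓ (s j · v)))
        (+-monoʳ-≤ (ℓ x) (ℓ≤-s· j v))))))
    (begin
      ℓ (s i · (x · q))   ≡⟨ ℓ-cong (s i · (x · q)) (x · (s j · q)) (λ k → commute (q ⟨$⟩ʳ k)) ⟩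
      ℓ (x · (s j · q))   ≤⟨ ℓ-· x (s j · q) ⟩
      ℓ x + ℓ (s j · q)   ≤⟨ +-monoʳ-≤ (ℓ x) (q-max j j∈) ⟩
      ℓ x + ℓ q           ≡⟨ ℓxq ⟨
      ℓ (x · q)           ∎)
    where
    open ≤-Reasoning
    commute : s i · x ≈ x · s j
    commute k = trans (shifts-conj x sh (x ⟨$⟩ʳ k)) (cong (λ k → x ⟨$⟩ʳ (s j ⟨$⟩ʳ k)) (inverseˡ x))

-- Reduced composition of cosets

module _ {I J K : Subset r} {p : Coset I J} {q : Coset J K}
         (x y : Permutation′ (suc r)) (x-block : IsBlock I J x) (y-block : IsBlock J K y)
         (x∼p : x ∼⟨ I , J ⟩ p) (y∼q : y ∼⟨ J , K ⟩ q)
         where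

  private
    wJ wK : Permutation′ (suc r)
    wJ = proj₁ (longest J)
    wK = proj₁ (longest K)

    wJ-longest : IsLongest J wJ
    wJ-longest = proj₂ (longest J)

    wK-longest : IsLongest K wK
    wK-longest = proj₂ (longest K)

    xy-block : IsBlock I K (x · y)
    xy-block = block-· x y x-block y-block

    ℓ-block : ∀ {I J} (y w : Permutation′ (suc r)) → IsBlock I J y → w ∈W J → ℓ (y · w) ≡ ℓ y + ℓ w
    ℓ-block y w B w∈ = additive⇒ℓ y w (ascending-additive y w (block-ascending y B) w∈)

    ℓ-x : ℓ (x · wJ) ≡ ℓ x + ℓ wJ
    ℓ-x = ℓ-block x wJ x-block (proj₁ wJ-longest)

    ℓ-y : ℓ (y · wK) ≡ ℓ y + ℓ wK
    ℓ-y = ℓ-block y wK y-block (proj₁ wK-longest)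

    ℓ-xy : ℓ (x · (y · wK)) ≡ ℓ (x · y) + ℓ wK
    ℓ-xy = trans (ℓ-cong (x · (y · wK)) (x · y · wK) λ _ → refl)
                 (ℓ-block (x · y) wK xy-block (proj₁ wK-longest))

  -- The maxima and w_J in the record are arbitrary witnesses, but each is unique up to `≈`. Hence
  -- the product is x y w_K, which lies in the coset of x y, and the lengths of w_J and w_K cancel.
  composite⇒additive : ∀ {c} → IsReducedComposite I J K p q c →
                       x · y ∼⟨ I , K ⟩ c × Additive x y
  composite⇒additive {c} R =
    ∼-trans (x · y) (p̄ * q̄) c
      (∼-trans (x · y) (x · y · wK) (p̄ * q̄)
        (∼-sym (x · y · wK) (x · y) (·∈W-∼ (x · y) wK (proj₁ wK-longest)))
        (≈⇒∼ (x · y · wK) (p̄ * q̄) λ k → sym (product′ k)))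
      (∼-sym c (p̄ * q̄) composite) ,
    ℓ⇒additive x y (+-cancelʳ-≡ (ℓ wK + ℓ wJ) _ _ (begin
      ℓ (x · y) + (ℓ wK + ℓ wJ)       ≡⟨ +-assoc (ℓ (x · y)) (ℓ wK) (ℓ wJ) ⟨
      ℓ (x · y) + ℓ wK + ℓ wJ         ≡⟨ cong (_+ ℓ wJ) ℓ-xy ⟨
      ℓ (x · (y · wK)) + ℓ wJ         ≡⟨ cong₂ _+_ (ℓ-cong (p̄ * q̄) (x · (y · wK)) product′)
                                           (ℓ-cong wJ′ wJ (longest-unique wJ′-longest wJ-longest)) ⟨
      ℓ (p̄ * q̄) + ℓ wJ′               ≡⟨ lengths ⟩
      ℓ p̄ + ℓ q̄                       ≡⟨ cong₂ _+_ (trans (ℓ-cong p̄ (x · wJ) p̄≈) ℓ-x)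
                                           (trans (ℓ-cong q̄ (y · wK) q̄≈) ℓ-y) ⟩
      ℓ x + ℓ wJ + (ℓ y + ℓ wK)       ≡⟨ rearrange (ℓ x) (ℓ wJ) (ℓ y) (ℓ wK) ⟩
      ℓ x + ℓ y + (ℓ wK + ℓ wJ)       ∎))
    where
    open IsReducedComposite R renaming (wJ to wJ′; wJ-longest to wJ′-longest)
    open ≡-Reasoning
    rearrange : ∀ a b c d → a + b + (c + d) ≡ a + c + (d + b)
    rearrange = solve-∀
    p̄≈ : p̄ ≈ x · wJ
    p̄≈ = maximal-unique p p̄-maximal (block-maximal p x wJ x-block x∼p wJ-longest)
    q̄≈ : q̄ ≈ y · wK
    q̄≈ = maximal-unique q q̄-maximal (block-maximal q y wK y-block y∼q wK-longest)
    product′ : p̄ * q̄ ≈ x · (y · wK)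
    product′ k = trans (product k) (trans (p̄≈ (wJ′ ⟨$⟩ˡ (q̄ ⟨$⟩ʳ k)))
      (cong (x ⟨$⟩ʳ_) (trans (sym (longest-unique wJ′-longest wJ-longest (wJ′ ⟨$⟩ˡ (q̄ ⟨$⟩ʳ k))))
        (trans (inverseʳ wJ′) (q̄≈ k)))))

  additive⇒composite : ∀ {c} → x · y ∼⟨ I , K ⟩ c → Additive x y → IsReducedComposite I J K p q c
  additive⇒composite {c} xy∼c add = record
    { p̄          = x · wJ
    ; q̄          = y · wK
    ; wJ         = wJ
    ; p̄-maximal  = block-maximal p x wJ x-block x∼p wJ-longest
    ; q̄-maximal  = block-maximal q y wK y-block y∼q wK-longest
    ; wJ-longest = wJ-longest
    ; product    = λ k → trans (product k) (cong (x ⟨$⟩ʳ_) (sym (inverseʳ wJ)))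
    ; lengths    = begin
        ℓ ((x · wJ) * (y · wK)) + ℓ wJ   ≡⟨ cong (_+ ℓ wJ)
                                             (ℓ-cong ((x · wJ) * (y · wK)) (x · (y · wK)) product) ⟩
        ℓ (x · (y · wK)) + ℓ wJ         ≡⟨ cong (_+ ℓ wJ) ℓ-xyw ⟩
        ℓ x + (ℓ y + ℓ wK) + ℓ wJ       ≡⟨ rearrange (ℓ x) (ℓ wJ) (ℓ y) (ℓ wK) ⟩
        ℓ x + ℓ wJ + (ℓ y + ℓ wK)       ≡⟨ cong₂ _+_ ℓ-x ℓ-y ⟨
        ℓ (x · wJ) + ℓ (y · wK)         ∎
    ; composite  = ∼-trans c (x · y) ((x · wJ) * (y · wK)) (∼-sym (x · y) c xy∼c)
        (∼-trans (x · y) (x · y · wK) ((x · wJ) * (y · wK))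
          (∼-sym (x · y · wK) (x · y) (·∈W-∼ (x · y) wK (proj₁ wK-longest)))
          (≈⇒∼ (x · y · wK) ((x · wJ) * (y · wK)) λ k → sym (product k)))
    }
    where
    open ≡-Reasoning
    rearrange : ∀ a b c d → a + (c + d) + b ≡ a + b + (c + d)
    rearrange = solve-∀
    ℓ-xyw : ℓ (x · (y · wK)) ≡ ℓ x + (ℓ y + ℓ wK)
    ℓ-xyw = trans ℓ-xy (trans (cong (_+ ℓ wK) (additive⇒ℓ x y add)) (+-assoc (ℓ x) (ℓ y) (ℓ wK)))
    -- `s j` passes through y to a reflection `s k` with k ∈ K, and `wK` is longest in W_K. This is
    -- what lets y · wK absorb w_J.
    q̄-max : ∀ j → j ∈ J → ℓ (s j · (y · wK)) ≤ ℓ (y · wK)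
    q̄-max j j∈ = let (k , k∈ , sh) = proj₂ y-block j j∈ in
      ≤-trans (≤-reflexive (ℓ-cong (s j · (y · wK)) (y · (s k · wK)) λ l →
                trans (shifts-conj y sh (y ⟨$⟩ʳ (wK ⟨$⟩ʳ l)))
                      (cong (λ l → y ⟨$⟩ʳ (s k ⟨$⟩ʳ l)) (inverseˡ y))))
      (≤-trans (ℓ-· y (s k · wK))
      (≤-trans (+-monoʳ-≤ (ℓ y) (proj₂ wK-longest (s k · wK)
                 (mul (s k) wK (gen k k∈ λ _ → refl) (proj₁ wK-longest) λ _ → refl)))
               (≤-reflexive (sym ℓ-y))))
    product : (x · wJ) * (y · wK) ≈ x · (y · wK)
    product = star (reducedWord (x · wJ)) x wJ (y · wK) (block-ascending x x-block) (proj₁ wJ-longest)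
      q̄-max (trans ℓ-xyw (cong (ℓ x +_) (sym ℓ-y))) (reducedWord-eval (x · wJ)) (≤-reflexive ℓ-x)

-- Squashing

-- The forward half of `onto`, for which composition is immediate. The converse follows from the
-- injectivity of σ, in `squashes-onto`.
Squashes : ∀ {k} → Subset r → Subset r → Permutation′ (suc r) → Permutation′ (suc k) → Set
Squashes I J y σ = ∀ x c → class J x ≡ toℕ c → class I (y ⟨$⟩ʳ x) ≡ toℕ (σ ⟨$⟩ʳ c)

classOf : (J : Subset r) → ∣ J ∣ ≡ m → ∀ x → ∃ λ (c : Fin (suc (r ∸ m))) → class J x ≡ toℕ c
classOf J refl x = Fin.fromℕ< (s≤s (class-bounded J x)) , sym (Fin.toℕ-fromℕ< _)

representative : (J : Subset r) → ∣ J ∣ ≡ m → (c : Fin (suc (r ∸ m))) → ∃ λ x → class J x ≡ toℕ c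
representative J refl c = class-onto J (toℕ c) (≤-pred (Fin.toℕ<n c))

block-class : {I J : Subset r} (y : Permutation′ (suc r)) → IsBlock I J y →
              ∀ {x x′} → class J x ≡ class J x′ → class I (y ⟨$⟩ʳ x) ≡ class I (y ⟨$⟩ʳ x′)
block-class {I = I} {J} y (y→ , _) {x} {x′} e = go (Fin.<-cmp x x′)
  where
  adjacent : ∀ j → j ∈ J → class I (y ⟨$⟩ʳ inject₁ j) ≡ class I (y ⟨$⟩ʳ suc j)
  adjacent j j∈ = let (i , i∈ , f , g) = y→ j j∈ in
    trans (cong (class I) f) (trans (class-step i∈) (cong (class I) (sym g)))
  propagate = chain (_≡_ on class I) trans J (y ⟨$⟩ʳ_) adjacent
  go : Tri (x Fin.< x′) (x ≡ x′) (x′ Fin.< x) → class I (y ⟨$⟩ʳ x) ≡ class I (y ⟨$⟩ʳ x′)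
  go (tri< x<x′ _ _) = propagate x x′ e x<x′
  go (tri≈ _ refl _) = refl
  go (tri> _ _ x′<x) = sym (propagate x′ x (sym e) x′<x)

module _ (I J : Subset r) {k m} (∣I∣ : ∣ I ∣ ≡ k) (∣J∣ : ∣ J ∣ ≡ m) where

  squashMap : (Fin (suc r) → Fin (suc r)) → Fin (suc (r ∸ m)) → Fin (suc (r ∸ k))
  squashMap f c = proj₁ (classOf I ∣I∣ (f (proj₁ (representative J ∣J∣ c))))

  squashMap-class : (y : Permutation′ (suc r)) → IsBlock I J y → ∀ x c → class J x ≡ toℕ c →
                    class I (y ⟨$⟩ʳ x) ≡ toℕ (squashMap (y ⟨$⟩ʳ_) c)
  squashMap-class y B x c e = let (z , f) = representative J ∣J∣ c in
    trans (block-class y B (trans e (sym f))) (proj₂ (classOf I ∣I∣ (y ⟨$⟩ʳ z)))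

squashMap-inverse : (I J : Subset r) → ∀ {k m} (∣I∣ : ∣ I ∣ ≡ k) (∣J∣ : ∣ J ∣ ≡ m)
  (y : Permutation′ (suc r)) → IsBlock I J y → ∀ c →
  squashMap I J ∣I∣ ∣J∣ (y ⟨$⟩ʳ_) (squashMap J I ∣J∣ ∣I∣ (y ⟨$⟩ˡ_) c) ≡ c
squashMap-inverse I J ∣I∣ ∣J∣ y B c =
  let (x , e) = representative I ∣I∣ c in
  Fin.toℕ-injective (trans
    (sym (squashMap-class I J ∣I∣ ∣J∣ y B (y ⟨$⟩ˡ x) _
           (squashMap-class J I ∣J∣ ∣I∣ (y ⁻¹) (block-⁻¹ y B) x c e)))
    (trans (cong (class I) (inverseʳ y)) e))

squash : (I J : Subset r) → ∀ {k m} → ∣ I ∣ ≡ k → ∣ J ∣ ≡ m → (y : Permutation′ (suc r)) →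
         IsBlock I J y → Permutation (suc (r ∸ m)) (suc (r ∸ k))
squash I J ∣I∣ ∣J∣ y B = permutation
  (squashMap I J ∣I∣ ∣J∣ (y ⟨$⟩ʳ_)) (squashMap J I ∣J∣ ∣I∣ (y ⟨$⟩ˡ_))
  (squashMap-inverse I J ∣I∣ ∣J∣ y B) (squashMap-inverse J I ∣J∣ ∣I∣ (y ⁻¹) (block-⁻¹ y B))

-- The classes of I and J are in bijection and hence equally many. For this reason `squash` is built
-- with two separate sizes.
block-size : {I J : Subset r} (y : Permutation′ (suc r)) → IsBlock I J y → ∣ I ∣ ≡ ∣ J ∣
block-size {I = I} {J} y B = ∸-cancelˡ-≡ (∣p∣≤n I) (∣p∣≤n J)
  (suc-injective (sym (↔⇒≡ (squash I J refl refl y B))))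

squashes-unique : {I J : Subset r} → ∣ J ∣ ≡ m → (y z : Permutation′ (suc r))
  (σ τ : Permutation′ (suc (r ∸ m))) → Squashes I J y σ → Squashes I J z τ → y ≈ z → σ ≈ τ
squashes-unique {I = I} {J} ∣J∣ y z σ τ yσ zτ e c = let (x , f) = representative J ∣J∣ c in
  Fin.toℕ-injective (trans (sym (yσ x c f)) (trans (cong (class I) (e x)) (zτ x c f)))

squashes-· : ∀ {k} {I J K : Subset r} (x y : Permutation′ (suc r)) (σ τ : Permutation′ (suc k)) →
             Squashes I J x σ → Squashes J K y τ → Squashes I K (x · y) (σ · τ)
squashes-· x y σ τ xσ yτ k c e = xσ (y ⟨$⟩ʳ k) (τ ⟨$⟩ʳ c) (yτ k c e)

squashes-onto : {I J : Subset r} → ∣ J ∣ ≡ m → (y : Permutation′ (suc r))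
  (σ : Permutation′ (suc (r ∸ m))) → Squashes I J y σ →
  ∀ x c → class I (y ⟨$⟩ʳ x) ≡ toℕ (σ ⟨$⟩ʳ c) → class J x ≡ toℕ c
squashes-onto {J = J} ∣J∣ y σ yσ x c e = let (d , f) = classOf J ∣J∣ x in
  trans f (cong toℕ (injective σ (Fin.toℕ-injective (trans (sym (yσ x d f)) e))))

squashes-⁻¹ : {I J : Subset r} → ∣ J ∣ ≡ m → (y : Permutation′ (suc r))
  (σ : Permutation′ (suc (r ∸ m))) → Squashes I J y σ → Squashes J I (y ⁻¹) (σ ⁻¹)
squashes-⁻¹ {I = I} ∣J∣ y σ yσ x c e = squashes-onto ∣J∣ y σ yσ (y ⟨$⟩ˡ x) (σ ⟨$⟩ˡ c)
  (trans (cong (class I) (inverseʳ y)) (trans e (cong toℕ (sym (inverseʳ σ)))))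

block-isSquash : {I J : Subset r} → ∣ J ∣ ≡ m → (y : Permutation′ (suc r)) → IsBlock I J y →
                 (σ : Permutation′ (suc (r ∸ m))) → Squashes I J y σ → IsSquash m I J y σ
block-isSquash ∣J∣ y B σ yσ = record
  { ∣I∣≡m = trans (block-size y B) ∣J∣
  ; ∣J∣≡m = ∣J∣
  ; onto  = λ c x → mk⇔ (yσ x c) (squashes-onto ∣J∣ y σ yσ x c)
  ; mono  = λ x x′ → ascending-< y (block-ascending y B)
  }

block-cosetSquash : {I J : Subset r} → ∣ J ∣ ≡ m → (p : Coset I J) (y : Permutation′ (suc r)) →
  IsBlock I J y → y ∼⟨ I , J ⟩ p → (σ : Permutation′ (suc (r ∸ m))) →
  Squashes I J y σ → IsCosetSquash m I J p σ
block-cosetSquash ∣J∣ p y B y∼p σ yσ = y , block-minimal p y B y∼p , block-isSquash ∣J∣ y B σ yσ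

cosetSquash-block : {I J : Subset r} (p : Coset I J) (y : Permutation′ (suc r)) →
  IsBlock I J y → y ∼⟨ I , J ⟩ p → {σ : Permutation′ (suc (r ∸ m))} →
  IsCosetSquash m I J p σ → Squashes I J y σ
cosetSquash-block {I = I} p y B y∼p (z , z-min , Q) x c e = trans
  (cong (class I) (minimal-unique p p (block-minimal p y B y∼p) z-min (∼-refl p) x))
  (Equivalence.to (IsSquash.onto Q c x) e)

squashes-id : {I J : Subset r} → ∣ J ∣ ≡ m → (z : Permutation′ (suc r)) → IsBlock I J z →
              Squashes I J z (idₚ {suc (r ∸ m)}) → z ≈ idₚ
squashes-id {I = I} {J} ∣J∣ z B zid = increasing⇒id z inc
  where
  class-z : ∀ x → class I (z ⟨$⟩ʳ x) ≡ class J x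
  class-z x = let (c , e) = classOf J ∣J∣ x in trans (zid x c e) (sym e)
  inc : ∀ j → z ⟨$⟩ʳ inject₁ j Fin.< z ⟨$⟩ʳ suc j
  inc j with j ∈? J
  ... | yes j∈ = block-ascending z B j j∈
  ... | no j∉  = class-<⇒< I _ _ (subst₂ _<_ (sym (class-z (inject₁ j))) (sym (class-z (suc j)))
                   (≤-reflexive (sym (class-∉ J j j∉))))

block-id⇒≡ : {I J : Subset r} (z : Permutation′ (suc r)) → IsBlock I J z → z ≈ idₚ → I ≡ J
block-id⇒≡ {I = I} {J} z (z→ , z←) e = ⊆-antisym
  (λ {i} i∈ → let (j , j∈ , f , _) = z← i i∈ in
    subst (_∈ J) (Fin.inject₁-injective (trans (sym (e (inject₁ j))) f)) j∈)
  (λ {j} j∈ → let (i , i∈ , f , _) = z→ j j∈ in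
    subst (_∈ I) (Fin.inject₁-injective (trans (sym f) (e (inject₁ j)))) i∈)

-- The quotient y′ · y⁻¹ is a block permutation relative to I′ and I with trivial squash, hence the
-- identity, and the identity can match I with I′ only if they coincide.
squash-injective : {I I′ J : Subset r} → ∣ J ∣ ≡ m → (y y′ : Permutation′ (suc r)) →
  IsBlock I J y → IsBlock I′ J y′ → (σ σ′ : Permutation′ (suc (r ∸ m))) →
  Squashes I J y σ → Squashes I′ J y′ σ′ → σ ≈ σ′ → I ≡ I′ × y ≈ y′
squash-injective {r} {m} {I} {I′} {J} ∣J∣ y y′ B B′ σ σ′ yσ y′σ′ e =
  sym (block-id⇒≡ z zB z≈id) , λ k → trans (sym (z≈id (y ⟨$⟩ʳ k)) ) (cong (y′ ⟨$⟩ʳ_) (inverseˡ y))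
  where
  z = y′ · y ⁻¹
  zB : IsBlock I′ I z
  zB = block-· y′ (y ⁻¹) B′ (block-⁻¹ y B)
  z≈id : z ≈ idₚ
  z≈id = squashes-id (trans (block-size y B) ∣J∣) z zB λ x c f →
    trans (squashes-· y′ (y ⁻¹) σ′ (σ ⁻¹) y′σ′ (squashes-⁻¹ ∣J∣ y σ yσ) x c f)
          (cong toℕ (trans (sym (e (σ ⟨$⟩ˡ c))) (inverseʳ σ)))

-- Points of different classes are ordered as their classes, so an inversion of τ lifts to
-- representatives. Comparing classes of images gives only ≤; injectivity of σ · τ makes it strict.
squashes-additive : {I J K : Subset r} → ∣ K ∣ ≡ m → (x y : Permutation′ (suc r))
  (σ τ : Permutation′ (suc (r ∸ m))) → Squashes I J x σ → Squashes J K y τ →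
  Additive x y → Additive σ τ
squashes-additive {I = I} {J} {K} ∣K∣ x y σ τ xσ yτ add c d c<d τd<τc =
  let (k , e) = representative K ∣K∣ c
      (l , f) = representative K ∣K∣ d
      k<l     = class-<⇒< K k l (subst₂ _<_ (sym e) (sym f) c<d)
      yl<yk   = class-<⇒< J _ _ (subst₂ _<_ (sym (yτ l d f)) (sym (yτ k c e)) τd<τc)
      xyσ     = squashes-· {K = K} x y σ τ xσ yτ
  in ≤∧≢⇒<
       (subst₂ _≤_ (xyσ l d f) (xyσ k c e) (class-mono I _ _ (<⇒≤ (add k l k<l yl<yk))))
       (λ g → <⇒≢ c<d (cong toℕ (sym (injective (σ · τ) (Fin.toℕ-injective g)))))

-- As y is increasing on K-classes, its inversions join different classes and descend to inversions
-- of τ.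
additive-squashes : {I J K : Subset r} → ∣ K ∣ ≡ m → (x y : Permutation′ (suc r)) →
  IsBlock J K y → (σ τ : Permutation′ (suc (r ∸ m))) → Squashes I J x σ → Squashes J K y τ →
  Additive σ τ → Additive x y
additive-squashes {I = I} {J} {K} ∣K∣ x y B σ τ xσ yτ add k l k<l yl<yk =
  let (c , e) = classOf K ∣K∣ k
      (d , f) = classOf K ∣K∣ l
      c≢d     = λ (g : c ≡ d) → <⇒≯ yl<yk (ascending-< y (block-ascending y B)
                  (trans e (trans (cong toℕ g) (sym f))) k<l)
      c<d     = ≤∧≢⇒< (subst₂ _≤_ e f (class-mono K k l (<⇒≤ k<l))) (c≢d ∘ Fin.toℕ-injective)
      τd<τc   = ≤∧≢⇒< (subst₂ _≤_ (yτ l d f) (yτ k c e) (class-mono J _ _ (<⇒≤ yl<yk)))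
                      (λ g → c≢d (sym (injective τ (Fin.toℕ-injective g))))
      xyσ     = squashes-· {K = K} x y σ τ xσ yτ
  in class-<⇒< I _ _ (subst₂ _<_ (sym (xyσ l d f)) (sym (xyσ k c e)) (add c d c<d τd<τc))

-- Atomic cosets

∉-remove : (M : Subset r) (b : Fin r) → b ∉ M - b
∉-remove (_ ∷ M) zero    ()
∉-remove (_ ∷ M) (suc b) (there b∈) = ∉-remove M b b∈

class-remove-≤ : {M : Subset r} {b : Fin r} → b ∈ M → ∀ x → x Fin.≤ inject₁ b →
                 class (M - b) x ≡ class M x
class-remove-≤                           b∈                 zero    _         = refl
class-remove-≤ {M = inside  ∷ M} {suc b} (there b∈) (suc x) (s≤s x≤b) = class-remove-≤ b∈ x x≤b
class-remove-≤ {M = outside ∷ M} {suc b} (there b∈) (suc x) (s≤s x≤b) =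
  cong suc (class-remove-≤ b∈ x x≤b)

class-remove-> : {M : Subset r} {b : Fin r} → b ∈ M → ∀ x → suc b Fin.≤ x →
                 class (M - b) x ≡ suc (class M x)
class-remove-> {M = inside  ∷ M} {zero}  here       (suc x) _         =
  cong (λ N → suc (class N x)) (p─⊥≡p M)
class-remove-> {M = inside  ∷ M} {suc b} (there b∈) (suc x) (s≤s b<x) = class-remove-> b∈ x b<x
class-remove-> {M = outside ∷ M} {suc b} (there b∈) (suc x) (s≤s b<x) =
  cong suc (class-remove-> b∈ x b<x)

∈W-mono : {I J : Subset r} {w : Permutation′ (suc r)} → I ⊆ J → w ∈W I → w ∈W J
∈W-mono I⊆J (gen i i∈ e)      = gen i (I⊆J i∈) e
∈W-mono I⊆J (one e)           = one e
∈W-mono I⊆J (mul y z y∈ z∈ e) = mul y z (∈W-mono I⊆J y∈) (∈W-mono I⊆J z∈) e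
∈W-mono I⊆J (inv y y∈ e)      = inv y (∈W-mono I⊆J y∈) e

s-toℕ-left : ∀ {k} (c : Fin k) (d : Fin (suc k)) → toℕ d ≡ toℕ c → toℕ (s c ⟨$⟩ʳ d) ≡ suc (toℕ c)
s-toℕ-left c d e = cong toℕ (trans
  (cong (s c ⟨$⟩ʳ_) (Fin.toℕ-injective (trans e (sym (Fin.toℕ-inject₁ c))))) (s-inject₁ c))

s-toℕ-right : ∀ {k} (c : Fin k) (d : Fin (suc k)) → toℕ d ≡ suc (toℕ c) → toℕ (s c ⟨$⟩ʳ d) ≡ toℕ c
s-toℕ-right c d e = trans (cong toℕ (trans (cong (s c ⟨$⟩ʳ_) (Fin.toℕ-injective e)) (s-suc c)))
                          (Fin.toℕ-inject₁ c)

s-toℕ-other : ∀ {k} (c : Fin k) (d : Fin (suc k)) → toℕ d ≢ toℕ c → toℕ d ≢ suc (toℕ c) →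
              toℕ (s c ⟨$⟩ʳ d) ≡ toℕ d
s-toℕ-other c d ≢₀ ≢₁ = cong toℕ (s-other c
  (λ e → ≢₀ (trans (cong toℕ e) (Fin.toℕ-inject₁ c))) (λ e → ≢₁ (cong toℕ e)))

module _ {M : Subset r} {a b : Fin r} {w wJ : Permutation′ (suc r)} (w-longest : IsLongest M w)
         (wJ-longest : IsLongest (M - b) wJ) (a∈M : a ∈ M) (b-def : s b ≈ w · s a · w) where

  private
    I J : Subset r
    I = M - a
    J = M - b

    w-class : ∀ x → class M (w ⟨$⟩ʳ x) ≡ class M x
    w-class = class-∈W (proj₁ w-longest)

    w-involutive : ∀ x → w ⟨$⟩ʳ (w ⟨$⟩ʳ x) ≡ x
    w-involutive = longest-involutive w-longest

    -- Membership is assumed for a. For b, the product w · s a · w preserves M-classes, so b and b +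
    -- 1 share one.
    b∈M : b ∈ M
    b∈M = class-step⁻¹ M b (sym (trans (cong (class M) (trans (sym (s-inject₁ b)) (b-def (inject₁ b))))
      (trans (w-class (s a ⟨$⟩ʳ (w ⟨$⟩ʳ inject₁ b)))
      (trans (class-∈W {w = s a} (gen a a∈M λ _ → refl) (w ⟨$⟩ʳ inject₁ b)) (w-class (inject₁ b))))))

    -- By `longest-flips` w carries the pair of b, reversed, to some pair i; the relation `b-def`
    -- makes `s a` exchange that pair, so i = a.
    w-b : w ⟨$⟩ʳ inject₁ b ≡ suc a × w ⟨$⟩ʳ suc b ≡ inject₁ a
    w-b = let (i , _ , e , f) = longest-flips w-longest b b∈M in
      trans e (cong suc (i≡a e f)) , trans f (cong inject₁ (i≡a e f))
      where
      w-suc-b : w ⟨$⟩ʳ suc b ≡ s a ⟨$⟩ʳ (w ⟨$⟩ʳ inject₁ b)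
      w-suc-b = trans (cong (w ⟨$⟩ʳ_) (trans (sym (s-inject₁ b)) (b-def (inject₁ b))))
                      (w-involutive (s a ⟨$⟩ʳ (w ⟨$⟩ʳ inject₁ b)))
      i≡a : ∀ {i} → w ⟨$⟩ʳ inject₁ b ≡ suc i → w ⟨$⟩ʳ suc b ≡ inject₁ i → i ≡ a
      i≡a {i} e f = Fin.inject₁-injective (proj₁ (s-raises a
        (subst (inject₁ i Fin.<_) (sym s-i) (inject₁<suc i))))
        where
        s-i : s a ⟨$⟩ʳ inject₁ i ≡ suc i
        s-i = trans (cong (s a ⟨$⟩ʳ_) (trans (sym f) (trans w-suc-b (cong (s a ⟨$⟩ʳ_) e))))
                    (s-involutive a (suc i))

  -- A pair of J is flipped by wJ within J and flipped back by w within M. It cannot land on a,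
  -- since w matches a with b alone, and b ∉ J.
  atomic-isBlock : IsBlock (M - a) (M - b) (w · wJ)
  atomic-isBlock =
    (λ j j∈ →
      let (k , k∈ , e , f) = longest-flips wJ-longest j j∈
          (i , i∈ , g , h) = longest-flips w-longest k (p─q⊆p M ⁅ b ⁆ k∈)
          i≢a = λ (i≡a : i ≡ a) → ∉-remove M b (subst (_∈ J)
                  (Fin.inject₁-injective (injective w (trans g (trans (cong suc i≡a) (sym (proj₁ w-b)))))) k∈)
      in i , x∈p∧x≢y⇒x∈p-y i∈ i≢a , trans (cong (w ⟨$⟩ʳ_) e) h , trans (cong (w ⟨$⟩ʳ_) f) g) ,
    (λ i i∈ →
      let (k , k∈ , e , f) = longest-flips w-longest i (p─q⊆p M ⁅ a ⁆ i∈)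
          k≢b = λ (k≡b : k ≡ b) → ∉-remove M a (subst (_∈ I)
                  (Fin.suc-injective (trans (sym (w-involutive (suc i)))
                    (trans (cong (w ⟨$⟩ʳ_) (trans f (cong inject₁ k≡b))) (proj₁ w-b)))) i∈)
          (j , j∈ , g , h) = longest-flips wJ-longest k (x∈p∧x≢y⇒x∈p-y k∈ k≢b)
          unflip = λ {x y} (e : wJ ⟨$⟩ʳ x ≡ y) →
            trans (cong (wJ ⟨$⟩ʳ_) (sym e)) (longest-involutive wJ-longest x)
      in j , j∈ ,
         trans (cong (w ⟨$⟩ʳ_) (trans (unflip h) (sym e))) (w-involutive (inject₁ i)) ,
         trans (cong (w ⟨$⟩ʳ_) (trans (unflip g) (sym f))) (w-involutive (suc i)))

  atomic-∼ : w · wJ ∼⟨ M - a , M - b ⟩ w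
  atomic-∼ = ·∈W-∼ w wJ (proj₁ wJ-longest)

  -- w · wJ swaps the two blocks into which b cuts its M-class.
  atomic-squashes : ∀ {k} (c : Fin k) → class (M - b) (inject₁ b) ≡ toℕ c →
                    Squashes (M - a) (M - b) (w · wJ) (s c)
  atomic-squashes c c-def x d e = cases (<-cmp (class M x) (class M (inject₁ b)))
    where
    c-def′ : class M (inject₁ b) ≡ toℕ c
    c-def′ = trans (sym (class-remove-≤ b∈M (inject₁ b) ≤-refl)) c-def
    wJ-class : class M (wJ ⟨$⟩ʳ x) ≡ class M x
    wJ-class = class-∈W (∈W-mono (p─q⊆p M ⁅ b ⁆) (proj₁ wJ-longest)) x
    y = w ⟨$⟩ʳ (wJ ⟨$⟩ʳ x)
    y-class : class M y ≡ class M x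
    y-class = trans (w-class (wJ ⟨$⟩ʳ x)) wJ-class
    a-class : class M (inject₁ a) ≡ class M (inject₁ b)
    a-class = trans (cong (class M) (sym (proj₂ w-b))) (trans (w-class (suc b)) (sym (class-step b∈M)))

    cases : Tri (class M x < class M (inject₁ b)) (class M x ≡ class M (inject₁ b))
                (class M (inject₁ b) < class M x) → class I y ≡ toℕ (s c ⟨$⟩ʳ d)
    -- Below the M-class of b neither cut, at a or at b, changes an index; above it each raises the
    -- index by one. Either way s c fixes the class.
    cases (tri< x<b _ _) = trans
      (trans (class-remove-≤ a∈M y (<⇒≤ (class-<⇒< M y (inject₁ a)
               (subst₂ _<_ (sym y-class) (sym a-class) x<b))))
             (trans y-class d-class))
      (sym (s-toℕ-other c d (<⇒≢ d<c) (<⇒≢ (<-trans d<c ≤-refl))))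
      where
      d-class : class M x ≡ toℕ d
      d-class = trans (sym (class-remove-≤ b∈M x (<⇒≤ (class-<⇒< M x (inject₁ b) x<b)))) e
      d<c : toℕ d < toℕ c
      d<c = subst₂ _<_ d-class c-def′ x<b
    cases (tri> _ _ b<x) = trans
      (trans (class-remove-> a∈M y (>inject₁⇒≥suc a
               (class-<⇒< M (inject₁ a) y (subst₂ _<_ (sym a-class) (sym y-class) b<x))))
             (trans (cong suc y-class) d-class))
      (sym (s-toℕ-other c d (<⇒≢ (<-trans ≤-refl c<d) ∘ sym) (<⇒≢ c<d ∘ sym)))
      where
      d-class : suc (class M x) ≡ toℕ d
      d-class = trans (sym (class-remove-> b∈M x (>inject₁⇒≥suc b (class-<⇒< M (inject₁ b) x b<x)))) e
      c<d : suc (toℕ c) < toℕ d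
      c<d = subst₂ _<_ (cong suc c-def′) d-class (s≤s b<x)
    -- Within this M-class wJ keeps each side of the cut b, while w reverses the whole class and
    -- takes b to a + 1, so the two sides trade places.
    cases (tri≈ _ x≈b _) = [ below , above ]′ (≤-<-connex (toℕ x) (toℕ (inject₁ b)))
      where
      wJx-class : class J (wJ ⟨$⟩ʳ x) ≡ toℕ d
      wJx-class = trans (class-∈W (proj₁ wJ-longest) x) e
      y-class′ : class M y ≡ toℕ c
      y-class′ = trans y-class (trans x≈b c-def′)
      below : x Fin.≤ inject₁ b → class I y ≡ toℕ (s c ⟨$⟩ʳ d)
      below x≤b = trans
        (trans (class-remove-> a∈M y (subst (Fin._≤ y) (proj₁ w-b)
                 (descending-≥ w (longest⇒descending w-longest) (trans wJ-class x≈b) wJx≤b)))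
               (cong suc y-class′))
        (sym (s-toℕ-left c d d≡c))
        where
        d≡c : toℕ d ≡ toℕ c
        d≡c = trans (sym e) (trans (class-remove-≤ b∈M x x≤b) (trans x≈b c-def′))
        -- Crossing the cut would raise the J-class by one, while wJ preserves J-classes.
        wJx≤b : wJ ⟨$⟩ʳ x Fin.≤ inject₁ b
        wJx≤b = ≮⇒≥ λ b<wJx → 1+n≢n (trans (sym (trans
          (class-remove-> b∈M (wJ ⟨$⟩ʳ x) (>inject₁⇒≥suc b b<wJx))
          (cong suc (trans wJ-class (trans x≈b c-def′))))) (trans wJx-class d≡c))
      above : inject₁ b Fin.< x → class I y ≡ toℕ (s c ⟨$⟩ʳ d)
      above b<x = trans
        (trans (class-remove-≤ a∈M y (subst (y Fin.≤_) (proj₂ w-b)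
                 (descending-≥ w (longest⇒descending w-longest)
                   (trans (sym (class-step b∈M)) (sym (trans wJ-class x≈b))) b<wJx)))
               y-class′)
        (sym (s-toℕ-right c d d≡1+c))
        where
        d≡1+c : toℕ d ≡ suc (toℕ c)
        d≡1+c = trans (sym e) (trans (class-remove-> b∈M x (>inject₁⇒≥suc b b<x))
                                     (cong suc (trans x≈b c-def′)))
        b<wJx : suc b Fin.≤ wJ ⟨$⟩ʳ x
        b<wJx = >inject₁⇒≥suc b (≰⇒> λ wJx≤b → 1+n≢n (trans (sym d≡1+c) (trans (sym wJx-class)
          (trans (class-remove-≤ b∈M (wJ ⟨$⟩ʳ x) wJx≤b) (trans wJ-class (trans x≈b c-def′))))))

atomic-block : {I J : Subset r} (p : Coset I J) (A : IsAtomic I J p) → ∣ J ∣ ≡ m →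
  ∃₂ λ (z : Permutation′ (suc r)) (c : Fin (r ∸ m)) →
    IsBlock I J z × z ∼⟨ I , J ⟩ p × toℕ c ≡ class J (inject₁ (IsAtomic.b A)) × Squashes I J z (s c)
atomic-block {r} p record { M = M ; a = a ; b = b ; wM = w ; a∈M = a∈M ; wM-longest = w-longest
                      ; b-def = b-def ; I-def = refl ; J-def = refl ; wM∈p = w∼p } refl =
  let (v , v-longest) = longest (M - b) in
  w · v , c , atomic-isBlock w-longest v-longest a∈M b-def ,
  ∼-trans (w · v) w p (atomic-∼ w-longest v-longest a∈M b-def) w∼p , c≡ ,
  atomic-squashes w-longest v-longest a∈M b-def c (sym c≡)
  where
  c< : class (M - b) (inject₁ b) < r ∸ ∣ M - b ∣
  -- As b ∉ J, the class of b + 1 is one higher and still bounded, so the class of b is not the last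
  -- and names a simple reflection.
  c< = subst (_≤ r ∸ ∣ M - b ∣) (class-∉ (M - b) b (∉-remove M b)) (class-bounded (M - b) (suc b))
  c = Fin.fromℕ< c<
  c≡ : toℕ c ≡ class (M - b) (inject₁ b)
  c≡ = Fin.toℕ-fromℕ< c<

-- Construction of atomic cosets with a given right-hand set

-- Classes c and c + 1 are separated by a missing generator b. Adding it to J merges the two blocks
-- to be swapped.
class-gap : (J : Subset r) (x : Fin (suc r)) → ∀ {c} → class J x ≡ suc c →
            ∃ λ b → b ∉ J × class J (inject₁ b) ≡ c
class-gap (inside ∷ J)  (suc x) e = let (b , b∉ , f) = class-gap J x e in
  suc b , (λ { (there b∈) → b∉ b∈ }) , f
class-gap (outside ∷ J) (suc x) {zero}  e = zero , (λ ()) , refl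
class-gap (outside ∷ J) (suc x) {suc c} e = let (b , b∉ , f) = class-gap J x (cong pred e) in
  suc b , (λ { (there b∈) → b∉ b∈ }) , cong suc f

insert-∈ : (J : Subset r) (b : Fin r) → b ∈ J [ b ]≔ inside
insert-∈ (_ ∷ J) zero    = here
insert-∈ (_ ∷ J) (suc b) = there (insert-∈ J b)

insert-remove : (J : Subset r) (b : Fin r) → b ∉ J → J [ b ]≔ inside - b ≡ J
insert-remove (inside  ∷ J) zero    b∉ = contradiction here b∉
insert-remove (outside ∷ J) zero    b∉ = cong (outside ∷_) (p─⊥≡p J)
insert-remove (x       ∷ J) (suc b) b∉ = cong (x ∷_) (insert-remove J b (b∉ ∘ there))

flips-conj : (w : Permutation′ (suc r)) {a b : Fin r} → w · w ≈ idₚ →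
             w ⟨$⟩ʳ inject₁ b ≡ suc a → w ⟨$⟩ʳ suc b ≡ inject₁ a → s b ≈ w · s a · w
flips-conj w {a} {b} w² e f k = trans (sym (w² (s b ⟨$⟩ʳ k))) (cong (w ⟨$⟩ʳ_) (commute k))
  where
  commute : ∀ k → w ⟨$⟩ʳ (s b ⟨$⟩ʳ k) ≡ s a ⟨$⟩ʳ (w ⟨$⟩ʳ k)
  commute k with position b k
  ... | left  = trans (cong (w ⟨$⟩ʳ_) (s-inject₁ b))
                      (trans f (sym (trans (cong (s a ⟨$⟩ʳ_) e) (s-suc a))))
  ... | right = trans (cong (w ⟨$⟩ʳ_) (s-suc b))
                      (trans e (sym (trans (cong (s a ⟨$⟩ʳ_) f) (s-inject₁ a))))
  ... | other ≢₀ ≢₁ = trans (cong (w ⟨$⟩ʳ_) (s-other b ≢₀ ≢₁)) (sym (s-other a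
    (λ g → ≢₁ (injective w (trans g (sym f)))) (λ g → ≢₀ (injective w (trans g (sym e))))))

isAtomic-insert : (J : Subset r) {a b : Fin r} (w : Permutation′ (suc r)) → b ∉ J →
  IsLongest (J [ b ]≔ inside) w → a ∈ J [ b ]≔ inside →
  w ⟨$⟩ʳ inject₁ b ≡ suc a → w ⟨$⟩ʳ suc b ≡ inject₁ a → IsAtomic (J [ b ]≔ inside - a) J w
isAtomic-insert J {a} {b} w b∉ w-longest a∈M e f = record
  { M          = J [ b ]≔ inside
  ; a          = a
  ; b          = b
  ; wM         = w
  ; a∈M        = a∈M
  ; wM-longest = w-longest
  ; b-def      = flips-conj w (longest-involutive w-longest) e f
  ; I-def      = refl
  ; J-def      = sym (insert-remove J b b∉)
  ; wM∈p       = ∼-refl w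
  }

AtomicInto : {m : ℕ} (J : Subset r) → Fin (r ∸ m) → Set
AtomicInto {r} J c = ∃₂ λ I (p : AtomicCoset I J) → ∃ λ z →
  IsBlock I J z × z ∼⟨ I , J ⟩ proj₁ p × Squashes I J z (s c)

-- Here M is J together with the cut b after class c. The left-hand set is then forced: it is M
-- without the a to which w_M flips b.
atomic-into : (J : Subset r) → ∣ J ∣ ≡ m → (c : Fin (r ∸ m)) → AtomicInto {m = m} J c
atomic-into {r} {m} J ∣J∣ c =
  let (x , e)       = representative J ∣J∣ (suc c)
      (b , b∉ , f)  = class-gap J x e
  in insert b b∉ f (longest (J [ b ]≔ inside))
  where
  insert : (b : Fin r) → b ∉ J → class J (inject₁ b) ≡ toℕ c →
           (∃ λ w → IsLongest (J [ b ]≔ inside) w) → AtomicInto {m = m} J c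
  insert b b∉ f (w , w-longest) =
    let (a , a∈M , g , h)             = longest-flips w-longest b (insert-∈ J b)
        A                             = isAtomic-insert J w b∉ w-longest a∈M g h
        (z , c′ , B , z∼w , c′≡ , zσ) = atomic-block w A ∣J∣
    in J [ b ]≔ inside - a , (w , A) , z , B , z∼w ,
       subst (λ c → Squashes (J [ b ]≔ inside - a) J z (s c)) (Fin.toℕ-injective (trans c′≡ f)) zσ

-- Atomic sequences

[]≢∷ʳ : ∀ {a} {A : Set a} (xs : List A) {x : A} → [] ≢ xs ++ x ∷ []
[]≢∷ʳ []       ()
[]≢∷ʳ (_ ∷ xs) ()

-- The comparison runs from the right, where the set is common to both sequences. The last letter
-- determines both the last coset and the set on its left, which starts the next comparison.
sequenceSquash-injective : {I J : Subset r} {ps qs : AtomicSequence I J} {u v : Word (r ∸ m)} →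
  ∣ J ∣ ≡ m → IsSequenceSquash m ps u → IsSequenceSquash m qs v → u ≡ v → ps ≋ qs
sequenceSquash-injective ∣K∣ []                  []                   e = []
sequenceSquash-injective ∣K∣ []                  (_∷ʳ_ {u = u} _ _)   e = contradiction e ([]≢∷ʳ u)
sequenceSquash-injective ∣K∣ (_∷ʳ_ {u = u} _ _) []                    e = contradiction (sym e) ([]≢∷ʳ u)
sequenceSquash-injective {I = I} ∣K∣
  (_∷ʳ_ {J = J} {K} {u} {c} {ps} {p , A} S Q) (_∷ʳ_ {J = J′} {u = u′} {c′} {ps′} {p′ , A′} S′ Q′) e =
  let (z  , _ , B  , z∼p   , _) = atomic-block p A ∣K∣
      (z′ , _ , B′ , z′∼p′ , _) = atomic-block p′ A′ ∣K∣
      (u≡u′ , c≡c′)             = ∷ʳ-injective u u′ e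
      (J≡J′ , z≈z′)             = squash-injective ∣K∣ z z′ B B′ (s c) (s c′)
        (cosetSquash-block p z B z∼p Q) (cosetSquash-block p′ z′ B′ z′∼p′ Q′)
        (λ k → cong (λ c → s c ⟨$⟩ʳ k) c≡c′)
  in snoc (trans (block-size z B) ∣K∣) u≡u′ J≡J′ z z′ z≈z′ z∼p z′∼p′
  where
  -- The two tails have the same type only once `J ≡ J′` is matched.
  snoc : ∣ J ∣ ≡ _ → u ≡ u′ → J ≡ J′ → ∀ z z′ → z ≈ z′ →
         z ∼⟨ J , K ⟩ p → z′ ∼⟨ J′ , K ⟩ p′ → (ps ∷ʳ (p , A)) ≋ (ps′ ∷ʳ (p′ , A′))
  snoc ∣J∣ u≡u′ refl z z′ z≈z′ z∼p z′∼p′ = sequenceSquash-injective ∣J∣ S S′ u≡u′ ∷ʳ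
    ∼-trans p z p′ (∼-sym z p z∼p) (∼-trans z z′ p′ (≈⇒∼ z z′ z≈z′) z′∼p′)

sequenceSquash-unique : {I J : Subset r} {ps qs : AtomicSequence I J} {u v : Word (r ∸ m)} →
  ps ≋ qs → IsSequenceSquash m ps u → IsSequenceSquash m qs v → u ≡ v
sequenceSquash-unique []         []                            []                = refl
sequenceSquash-unique (_∷ʳ_ {p = p , _} {q , _} es e)
  (_∷ʳ_ {c = c} S (y , y-min , Q)) (_∷ʳ_ {c = d} S′ (z , z-min , Q′)) =
  cong₂ (λ u c → u ++ c ∷ []) (sequenceSquash-unique es S S′)
    (s-injective (squashes-unique (IsSquash.∣J∣≡m Q) y z (s c) (s d)
      (λ x c → Equivalence.to (IsSquash.onto Q c x)) (λ x c → Equivalence.to (IsSquash.onto Q′ c x))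
      (minimal-unique p q y-min z-min e)))

-- Squashing reduced atomic sequences

-- An induction invariant: reducedness of the extended word relies on the block and squash data of
-- the prefix, so everything is carried along together.
record Analysis (m : ℕ) {I J : Subset r} (ps : AtomicSequence I J) (c : Coset I J) : Set where
  field
    y        : Permutation′ (suc r)
    word     : Word (r ∸ m)
    block    : IsBlock I J y
    y∼c      : y ∼⟨ I , J ⟩ c
    squash-≡ : IsSequenceSquash m ps word
    squashes : Squashes I J y (eval word)
    reduced  : length word ≡ ℓ (eval word)

squashes-resp : ∀ {k} {I J : Subset r} (y : Permutation′ (suc r)) (σ τ : Permutation′ (suc k)) →
                σ ≈ τ → Squashes I J y σ → Squashes I J y τ
squashes-resp y σ τ e yσ x c f = trans (yσ x c f) (cong toℕ (e c))

eval-∷ʳ : (u : Word r) (c : Fin r) → eval (u ++ c ∷ []) ≈ eval u · s c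
eval-∷ʳ u c = eval-++ u (c ∷ [])

ℓ-∷ʳ : (u : Word r) (c : Fin r) → Additive (eval u) (s c) → ℓ (eval (u ++ c ∷ [])) ≡ ℓ (eval u) + 1
ℓ-∷ʳ u c add = trans (ℓ-cong (eval (u ++ c ∷ [])) (eval u · s c) (eval-∷ʳ u c))
  (trans (additive⇒ℓ (eval u) (s c) add) (cong (ℓ (eval u) +_) (ℓ-s c)))

-- A reduced composite makes the block representatives additive. This descends to the squashes, so
-- each new letter raises the length by one.
analyse : {I J : Subset r} {ps : AtomicSequence I J} {c : Coset I J} →
          ∣ J ∣ ≡ m → ps ↠ c → Analysis m ps c
analyse {r} {m} ∣J∣ ([] {c = c} c∼id) = record
  { y        = idₚ
  ; word     = []
  ; block    = block-id
  ; y∼c      = ∼-sym c idₚ c∼id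
  ; squash-≡ = []
  ; squashes = λ x c e → e
  ; reduced  = sym (ℓ-id {r ∸ m})
  }
analyse {r} {m} {I} ∣K∣ (_∷ʳ_ {J} {K} {c} {d} {ps} {p , A} R C) =
  snoc (atomic-block p A ∣K∣)
  where
  snoc : (∃₂ λ z (c : Fin (r ∸ m)) → IsBlock J K z × z ∼⟨ J , K ⟩ p × toℕ c ≡ _ × Squashes J K z (s c)) →
         Analysis m (ps ∷ʳ (p , A)) d
  snoc (z , i , B , z∼p , _ , zσ) = record
    { y        = y · z
    ; word     = word ++ i ∷ []
    ; block    = block-· y z block B
    ; y∼c      = proj₁ composite
    ; squash-≡ = squash-≡ ∷ʳ block-cosetSquash ∣K∣ p z B z∼p (s i) zσ
    ; squashes = squashes-resp (y · z) (eval word · s i) (eval (word ++ i ∷ []))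
        (λ k → sym (eval-∷ʳ word i k)) (squashes-· y z (eval word) (s i) squashes zσ)
    ; reduced  = trans (length-++ word) (trans (cong (_+ 1) reduced)
        (sym (ℓ-∷ʳ word i (squashes-additive ∣K∣ y z (eval word) (s i) squashes zσ (proj₂ composite)))))
    }
    where
    open Analysis (analyse {m = m} (trans (block-size z B) ∣K∣) R)
    composite : y · z ∼⟨ I , K ⟩ d × Additive y z
    composite = composite⇒additive y z block B y∼c z∼p C

-- Lifting words to atomic sequences

-- The last letter adds at most one to the length, so a prefix of a reduced word has no room to be
-- shortened.
reduced-∷ʳ : (u : Word r) (c : Fin r) → length (u ++ c ∷ []) ≡ ℓ (eval (u ++ c ∷ [])) →
             length u ≡ ℓ (eval u) × Additive (eval u) (s c)
reduced-∷ʳ u c e = u-reduced , ℓ⇒additive (eval u) (s c)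
  (trans (sym e′) (trans (cong (_+ 1) u-reduced) (cong (ℓ (eval u) +_) (sym (ℓ-s c)))))
  where
  e′ : length u + 1 ≡ ℓ (eval u · s c)
  e′ = trans (sym (length-++ u)) (trans e (ℓ-cong (eval (u ++ c ∷ [])) (eval u · s c) (eval-∷ʳ u c)))
  u-reduced : length u ≡ ℓ (eval u)
  u-reduced = ≤-antisym
    (+-cancelʳ-≤ 1 _ _ (subst₂ _≤_ (sym e′) (cong (ℓ (eval u) +_) (ℓ-s c)) (ℓ-· (eval u) (s c))))
    (ℓ-minimal (eval u) u λ _ → refl)

lift : {I J : Subset r} → ∣ J ∣ ≡ m → {u : Word (r ∸ m)} → Reverse u →
       (y : Permutation′ (suc r)) → IsBlock I J y → Squashes I J y (eval u) →
       length u ≡ ℓ (eval u) → (c : Coset I J) → y ∼⟨ I , J ⟩ c →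
       Σ (AtomicSequence I J) λ ps → ps ↠ c × IsSequenceSquash m ps u
-- I was prescribed together with y. When no letters remain, the trivial squash forces I = J, as the
-- empty sequence requires.
lift {r} {m} {I} {J} ∣J∣ [] y B yσ red c y∼c = empty (block-id⇒≡ y B y≈id)
  where
  y≈id : y ≈ idₚ
  y≈id = squashes-id ∣J∣ y B yσ
  empty : I ≡ J → Σ (AtomicSequence I J) λ ps → ps ↠ c × IsSequenceSquash m ps []
  empty refl = [] , [] (∼-trans c y idₚ (∼-sym y c y∼c) (≈⇒∼ y idₚ y≈id)) , []
lift {r} {m} {I} {K} ∣K∣ (u ∶ rev ∶ʳ i) y B yσ red c y∼c = snoc (atomic-into K ∣K∣ i)
  where
  snoc : AtomicInto {m = m} K i →
         Σ (AtomicSequence I K) λ ps → ps ↠ c × IsSequenceSquash m ps (u ++ i ∷ [])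
  snoc (J , (p , A) , z , zB , z∼p , zσ) =
    let (u-reduced , add) = reduced-∷ʳ u i red
        -- Dividing y by the last atomic block permutation leaves one that squashes to the value of
        -- the prefix u.
        x                 = y · z ⁻¹
        xB                = block-· y (z ⁻¹) B (block-⁻¹ z zB)
        xσ                = squashes-resp x (eval (u ++ i ∷ []) · s i ⁻¹) (eval u)
          (λ k → trans (eval-∷ʳ u i (s i ⟨$⟩ˡ k)) (cong (eval u ⟨$⟩ʳ_) (inverseʳ (s i))))
          (squashes-· y (z ⁻¹) (eval (u ++ i ∷ [])) (s i ⁻¹) yσ (squashes-⁻¹ ∣K∣ z (s i) zσ))
        (ps , R , S)      = lift (trans (block-size z zB) ∣K∣) rev x xB xσ u-reduced x (∼-refl x)
    in ps ∷ʳ (p , A) ,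
       R ∷ʳ additive⇒composite x z xB zB (∼-refl x) z∼p
         (∼-trans (x · z) y c (≈⇒∼ (x · z) y λ k → cong (y ⟨$⟩ʳ_) (inverseˡ z)) y∼c)
         (additive-squashes ∣K∣ x z zB (eval u) (s i) xσ zσ add) ,
       S ∷ʳ block-cosetSquash ∣K∣ p z zB z∼p (s i) zσ

-- With J fixed on the right, each letter multiplies on the left by an atomic block permutation into
-- the current left-hand set; the set I is an output.
realise : (J : Subset r) → ∣ J ∣ ≡ m → (u : Word (r ∸ m)) →
          ∃₂ λ I y → IsBlock I J y × Squashes I J y (eval u)
realise J ∣J∣ []      = J , idₚ , block-id , λ x c e → e
realise J ∣J∣ (i ∷ u) =
  let (I , y , B , yσ)              = realise J ∣J∣ u
      (H , _ , z , zB , _ , zσ)     = atomic-into I (trans (block-size y B) ∣J∣) i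
  in H , z · y , block-· z y zB B , squashes-· z y (s i) (eval u) zσ yσ

-- The squashing bijections

module _ {r m : ℕ} (J : Subset r) (∣J∣ : ∣ J ∣ ≡ m) where

  open CoreCoset

  minimal : CoreCoset J → Permutation′ (suc r)
  minimal P = proj₁ (isCore P)

  minimal-isMinimal : (P : CoreCoset J) → IsMinimal (I P) J (p P) (minimal P)
  minimal-isMinimal P = proj₁ (proj₂ (isCore P))

  minimal-isBlock : (P : CoreCoset J) → IsBlock (I P) J (minimal P)
  minimal-isBlock P = core⇒block (p P) (isCore P)

  minimal-∼ : (P : CoreCoset J) → minimal P ∼⟨ I P , J ⟩ p P
  minimal-∼ P = proj₁ (minimal-isMinimal P)

  𝕊q : CoreCoset J → Permutation′ (suc (r ∸ m))
  𝕊q P = squash (I P) J (trans (block-size (minimal P) (minimal-isBlock P)) ∣J∣) ∣J∣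
                (minimal P) (minimal-isBlock P)

  𝕊q-squashes : (P : CoreCoset J) → Squashes (I P) J (minimal P) (𝕊q P)
  𝕊q-squashes P = squashMap-class (I P) J (trans (block-size (minimal P) (minimal-isBlock P)) ∣J∣) ∣J∣
                                  (minimal P) (minimal-isBlock P)

  -- A block permutation in the coset is its minimum, so it may replace the witness from which `𝕊q`
  -- is built.
  block-𝕊q : (P : CoreCoset J) (y : Permutation′ (suc r)) → IsBlock (I P) J y →
             y ∼⟨ I P , J ⟩ p P → (σ : Permutation′ (suc (r ∸ m))) → Squashes (I P) J y σ → σ ≈ 𝕊q P
  block-𝕊q P y B y∼p σ yσ = squashes-unique ∣J∣ y (minimal P) σ (𝕊q P) yσ (𝕊q-squashes P)
    (minimal-unique (p P) (p P) (block-minimal (p P) y B y∼p) (minimal-isMinimal P) (∼-refl (p P)))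

  𝕊q-cong : (P Q : CoreCoset J) → I P ≡ I Q → p P ∼⟨ I P , J ⟩ p Q → 𝕊q P ≈ 𝕊q Q
  𝕊q-cong P Q refl e = squashes-unique ∣J∣ (minimal P) (minimal Q) (𝕊q P) (𝕊q Q)
    (𝕊q-squashes P) (𝕊q-squashes Q)
    (minimal-unique (p P) (p Q) (minimal-isMinimal P) (minimal-isMinimal Q) e)

  𝕊q-injective : (P Q : CoreCoset J) → 𝕊q P ≈ 𝕊q Q → I P ≡ I Q × p P ∼⟨ I P , J ⟩ p Q
  𝕊q-injective P Q e =
    let (I≡ , y≈) = squash-injective ∣J∣ (minimal P) (minimal Q) (minimal-isBlock P) (minimal-isBlock Q)
                      (𝕊q P) (𝕊q Q) (𝕊q-squashes P) (𝕊q-squashes Q) e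
    in I≡ , ∼-trans (p P) (minimal P) (p Q) (∼-sym (minimal P) (p P) (minimal-∼ P))
         (∼-trans (minimal P) (minimal Q) (p Q) (≈⇒∼ (minimal P) (minimal Q) y≈)
           (subst (λ I → minimal Q ∼⟨ I , J ⟩ p Q) (sym I≡) (minimal-∼ Q)))

  𝕊q-surjective : (σ : Permutation′ (suc (r ∸ m))) →
                  ∃ λ (P : CoreCoset J) → ∀ {Q} → I Q ≡ I P × p Q ∼⟨ I Q , J ⟩ p P → 𝕊q Q ≈ σ
  𝕊q-surjective σ = realised (generated σ)
    where
    preimage : ∀ u → eval u ≈ σ → (∃₂ λ H y → IsBlock H J y × Squashes H J y (eval u)) →
               ∃ λ (P : CoreCoset J) → ∀ {Q} → I Q ≡ I P × p Q ∼⟨ I Q , J ⟩ p P → 𝕊q Q ≈ σ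
    preimage u e (H , y , B , yσ) = core H y (block⇒core y B) , λ {Q} (f , g) k →
      trans (𝕊q-cong Q (core H y (block⇒core y B)) f g k)
        (trans (sym (block-𝕊q (core H y (block⇒core y B)) y B (∼-refl y) (eval u) yσ k)) (e k))
    realised : (∃ λ u → eval u ≈ σ) →
               ∃ λ (P : CoreCoset J) → ∀ {Q} → I Q ≡ I P × p Q ∼⟨ I Q , J ⟩ p P → 𝕊q Q ≈ σ
    realised (u , e) = preimage u e (realise J ∣J∣ u)

  𝕊q-bijection : Bijection (CoreCosets J) (Sym (suc (r ∸ m)))
  𝕊q-bijection = record
    { to        = 𝕊q
    ; cong      = λ {P} {Q} (e , f) → 𝕊q-cong P Q e f
    ; bijective = (λ {P} {Q} → 𝕊q-injective P Q) , 𝕊q-surjective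
    }

  𝕊q-cosetSquash : (P : CoreCoset J) → IsCosetSquash m (I P) J (p P) (𝕊q P)
  𝕊q-cosetSquash P = block-cosetSquash ∣J∣ (p P) (minimal P) (minimal-isBlock P) (minimal-∼ P)
                                       (𝕊q P) (𝕊q-squashes P)

  module _ (P : CoreCoset J) where

    expression : (e : AtomicReducedExpression (I P) J (p P)) → Analysis m (proj₁ e) (p P)
    expression (ps , R) = analyse ∣J∣ R

    squashExpression : AtomicReducedExpression (I P) J (p P) → ReducedExpression (𝕊q P)
    squashExpression e = word , eval≈ ,
      trans reduced (ℓ-cong (eval word) (𝕊q P) eval≈)
      where
      open Analysis (expression e)
      eval≈ : eval word ≈ 𝕊q P
      eval≈ = block-𝕊q P y block y∼c (eval word) squashes

    squashExpression-cong : (e f : AtomicReducedExpression (I P) J (p P)) → proj₁ e ≋ proj₁ f →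
                            proj₁ (squashExpression e) ≡ proj₁ (squashExpression f)
    squashExpression-cong e f e≋f = sequenceSquash-unique e≋f
      (Analysis.squash-≡ (expression e)) (Analysis.squash-≡ (expression f))

    squashExpression-surjective : (u : ReducedExpression (𝕊q P)) →
      ∃ λ e → ∀ {f} → proj₁ f ≋ proj₁ e → proj₁ (squashExpression f) ≡ proj₁ u
    squashExpression-surjective (u , u≈ , u-reduced) = lifted
      (lift ∣J∣ (reverseView u) (minimal P) (minimal-isBlock P)
        (squashes-resp (minimal P) (𝕊q P) (eval u) (λ k → sym (u≈ k)) (𝕊q-squashes P))
        (trans u-reduced (ℓ-cong (𝕊q P) (eval u) λ k → sym (u≈ k))) (p P) (minimal-∼ P))
      where
      lifted : (Σ (AtomicSequence (I P) J) λ ps → ps ↠ p P × IsSequenceSquash m ps u) →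
               ∃ λ e → ∀ {f} → proj₁ f ≋ proj₁ e → proj₁ (squashExpression f) ≡ u
      lifted (ps , R , S) =
        (ps , R) , λ {f} f≋ → sequenceSquash-unique f≋ (Analysis.squash-≡ (expression f)) S

    squashExpression-bijection :
      Bijection (AtomicReducedExpressions (I P) J (p P)) (ReducedExpressions (𝕊q P))
    squashExpression-bijection = record
      { to        = squashExpression
      ; cong      = λ {e} {f} → squashExpression-cong e f
      ; bijective = (λ {e} {f} → sequenceSquash-injective ∣J∣
                        (Analysis.squash-≡ (expression e)) (Analysis.squash-≡ (expression f)))
                  , squashExpression-surjective
      }

theorem1p14 : (r m : ℕ) (J : Subset r) → ∣ J ∣ ≡ m →
    Σ (Bijection (CoreCosets J) (Sym (suc (r ∸ m)))) λ Sq →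
    ((p : CoreCoset J) →
    IsCosetSquash m (CoreCoset.I p) J (CoreCoset.p p) (Bijection.to Sq p))
    × ((p : CoreCoset J) →
    Σ (Bijection (AtomicReducedExpressions (CoreCoset.I p) J (CoreCoset.p p))
    (ReducedExpressions (Bijection.to Sq p))) λ Sqs →
    (e : AtomicReducedExpression (CoreCoset.I p) J (CoreCoset.p p)) →
    IsSequenceSquash m (proj₁ e) (proj₁ (Bijection.to Sqs e)))
theorem1p14 r m J ∣J∣ = 𝕊q-bijection J ∣J∣ , 𝕊q-cosetSquash J ∣J∣ , λ P →
  squashExpression-bijection J ∣J∣ P , λ e → Analysis.squash-≡ (expression J ∣J∣ P e)
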